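{- Let $\delta\geq 2$ be a squarefree integer. Then the real quadratic field $\mathbb{Q}[\sqrt{\delta}]$ contains infinitely many periodic continued fractions uniformly bounded by $4\lfloor\sqrt{\delta}\rfloor+1$, i.e. infinitely many real numbers $[\overline{a_0,a_1,\dots,a_n}]\in\mathbb{Q}[\sqrt{\delta}]$ with $1\le a_i\le 4\lfloor\sqrt{\delta}\rfloor+1$ for all $i$.
   Context: For positive integers $a_0,\dots,a_n$, $[\overline{a_0,\dots,a_n}]$ denotes the real number whose continued fraction expansion is purely periodic with period $(a_0,\dots,a_n)$. -}

module Defs where

open import Data.Integer.Base as ℤ using (+_)
open import Data.Nat.Base as ℕ using (ℕ; zero; suc)
open import Data.Nat.Divisibility using (_∣_)
open import Data.Nat.DivMod using (_mod_)
open import Data.Nat.Properties as ℕ using ()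
open import Data.Product.Base using (_×_; _,_; ∃-syntax)
open import Data.Rational.Base as ℚ using (ℚ; 0ℚ; 1ℚ)
open import Data.Vec.Base using (Vec; lookup)
open import Function.Definitions using (Injective)
open import Relation.Binary.PropositionalEquality using (_≡_)
open import Relation.Nullary using (yes; no)

Squarefree : ℕ → Set
Squarefree n = ∀ d → d ℕ.* d ∣ n → d ≡ 1

-- If s = ⌊√n⌋ then raise (1 + n) s = ⌊√(1 + n)⌋.
raise : ℕ → ℕ → ℕ
raise n s with suc s ℕ.* suc s ℕ.≤? n
... | yes _ = suc s
... | no  _ = s

⌊√_⌋ : ℕ → ℕ
⌊√ zero ⌋  = zero
⌊√ suc n ⌋ = raise (suc n) ⌊√ n ⌋

⌊√⌋-spec : ∀ n → ⌊√ n ⌋ ℕ.* ⌊√ n ⌋ ℕ.≤ n × n ℕ.< suc ⌊√ n ⌋ ℕ.* suc ⌊√ n ⌋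
⌊√⌋-spec zero = ℕ.z≤n , ℕ.s≤s ℕ.z≤n
⌊√⌋-spec (suc n) = raise-spec ⌊√ n ⌋ (⌊√⌋-spec n)
  where
  raise-spec : ∀ s → s ℕ.* s ℕ.≤ n × n ℕ.< suc s ℕ.* suc s →
    let r = raise (suc n) s in r ℕ.* r ℕ.≤ suc n × suc n ℕ.< suc r ℕ.* suc r
  raise-spec s (≤n , n<) with suc s ℕ.* suc s ℕ.≤? suc n
  ... | yes p = p , ℕ.≤-<-trans n< (ℕ.*-mono-< (ℕ.n<1+n (suc s)) (ℕ.n<1+n (suc s)))
  ... | no ¬p = ℕ.m≤n⇒m≤1+n ≤n , ℕ.≰⇒> ¬p

-- The element (re , im) is re + im √δ.  When δ is not a perfect square this
-- representation is unique, so _≡_ is equality of the represented numbers.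
record ℚ[√_] (δ : ℕ) : Set where
  constructor _+_√
  field
    re im : ℚ

open ℚ[√_] public

module _ {δ : ℕ} where

  infixl 6 _-_
  infixl 7 _*_
  infix  4 _≤_ _<_

  fromℚ : ℚ → ℚ[√ δ ]
  fromℚ q = q + 0ℚ √

  fromℕ : ℕ → ℚ[√ δ ]
  fromℕ n = fromℚ (+ n ℚ./ 1)

  _-_ : ℚ[√ δ ] → ℚ[√ δ ] → ℚ[√ δ ]
  (a + b √) - (c + d √) = (a ℚ.- c) + (b ℚ.- d) √

  _*_ : ℚ[√ δ ] → ℚ[√ δ ] → ℚ[√ δ ]
  (a + b √) * (c + d √) =
    (a ℚ.* c ℚ.+ (+ δ ℚ./ 1) ℚ.* (b ℚ.* d)) + (a ℚ.* d ℚ.+ b ℚ.* c) √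

  -- A rational with the same sign as the real number a + b √δ (√δ ≥ 0):
  -- t ↦ t ∣t∣ is odd and strictly increasing on ℝ, so a > - b √δ if and only
  -- if a ∣a∣ > - δ b ∣b∣, and likewise for ≥.
  signed : ℚ[√ δ ] → ℚ
  signed (a + b √) = a ℚ.* ℚ.∣ a ∣ ℚ.+ (+ δ ℚ./ 1) ℚ.* (b ℚ.* ℚ.∣ b ∣)

  -- The order induced by the embedding into ℝ with √δ ≥ 0.
  _≤_ _<_ : ℚ[√ δ ] → ℚ[√ δ ] → Set
  x ≤ y = 0ℚ ℚ.≤ signed (y - x)
  x < y = 0ℚ ℚ.< signed (y - x)

  -- The infinite continued fraction expansion of x is [a 0 , a 1 , …]: with
  -- x₀ = x one has a k = ⌊ x_k ⌋ and x_{k+1} = 1 / (x_k - a k) for all k.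
  record HasExpansion (x : ℚ[√ δ ]) (a : ℕ → ℕ) : Set where
    field
      completeQuotient : ℕ → ℚ[√ δ ]
      start   : completeQuotient 0 ≡ x
      floor-≤ : ∀ k → fromℕ (a k) ≤ completeQuotient k
      floor-< : ∀ k → completeQuotient k < fromℕ (suc (a k))
      step    : ∀ k → (completeQuotient k - fromℕ (a k)) * completeQuotient (suc k)
                      ≡ fromℚ 1ℚ

  infix 4 _≡[_]‾

  -- x is the number whose expansion is purely periodic with period a.
  _≡[_]‾ : ∀ {n} → ℚ[√ δ ] → Vec ℕ (suc n) → Set
  _≡[_]‾ {n} x a = HasExpansion x (λ k → lookup a (k mod suc n))

InfinitelyMany : {A : Set} → (A → Set) → Set
InfinitelyMany {A} P = ∃[ f ] Injective {A = ℕ} {B = A} _≡_ _≡_ f × (∀ i → P (f i))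

{-# OPTIONS --safe #-}
module Submission where

-- Let s = ⌊√δ⌋ and √δ = [s; t, 2s, t, 2s, …].  In the basis s + √δ, 1 the matrix of
-- the word 2s, t is that of multiplication by a unit p + e √δ; write U for the
-- matrix [[p,δe],[e,p]] of this unit in the basis √δ, 1.  Replacing t by t, 2s, t
-- squares the unit, so its norm may be taken to be 1.  Put X = [[1,0],[2,-1]] and
-- Y = [[-1,2],[0,1]].  Then Y U X U has the trace 2 (p² + δ e²) of U², hence its
-- eigenvalues lie in ℚ(√δ), and its fixed point is 1 - δ e / p + (e / p) √δ.
-- Conjugated by [[1,s],[0,1]], X turns the initial 2s of the word 2s, t into
-- s, 1, 1, s - 1, while Y turns 2s, c into 1, 1, c - 1.  So this fixed point plus s is
-- purely periodic with digits at most 2s + 1; a digit 0 that arises when s = 1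
-- or c = 1 is absorbed by [x, 0, y] = [x + y].  Repeated squaring of the unit
-- increases e / p, which makes these numbers distinct.

import Defs
open import Defs using (ℚ[√_]; ⌊√_⌋; ⌊√⌋-spec; Squarefree; InfinitelyMany; _≡[_]‾)
open import Data.Empty using (⊥-elim)
open import Data.List.Base as List using (List; []; _∷_; _++_; applyUpTo; foldr)
open import Data.Product.Base using (_×_; _,_; proj₁; proj₂; ∃-syntax; Σ-syntax)
open import Data.Sum.Base as Sum using (_⊎_; inj₁; inj₂; [_,_]′)
open import Relation.Binary.Definitions using (tri<; tri≈; tri>)
open import Relation.Binary.PropositionalEquality
open import Relation.Nullary using (yes; no)

-- Matrices of words

module Matrices where

  open import Data.Nat.Base
  open import Data.Nat.Properties
  open import Data.Nat.Tactic.RingSolver using (solve-∀)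

  -- mat a b c d is the matrix [[a,b],[c,d]].
  record Mat : Set where
    constructor mat
    field
      a₁₁ a₁₂ a₂₁ a₂₂ : ℕ

  infixr 7 _⊗_

  _⊗_ : Mat → Mat → Mat
  mat a b c d ⊗ mat a′ b′ c′ d′ =
    mat (a * a′ + b * c′) (a * b′ + b * d′) (c * a′ + d * c′) (c * b′ + d * d′)

  I : Mat
  I = mat 1 0 0 1

  -- quot x M = [[x,1],[1,0]] M
  quot : ℕ → Mat → Mat
  quot x (mat a b c d) = mat (x * a + c) (x * b + d) a b

  word : List ℕ → Mat
  word = foldr quot I

  mat-cong : ∀ {a a′ b b′ c c′ d d′} → a ≡ a′ → b ≡ b′ → c ≡ c′ → d ≡ d′ →
    mat a b c d ≡ mat a′ b′ c′ d′
  mat-cong refl refl refl refl = refl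

  mat-injective : ∀ {a a′ b b′ c c′ d d′} → mat a b c d ≡ mat a′ b′ c′ d′ →
    (a ≡ a′ × b ≡ b′) × (c ≡ c′ × d ≡ d′)
  mat-injective refl = (refl , refl) , (refl , refl)

  I-⊗ : ∀ M → I ⊗ M ≡ M
  I-⊗ (mat a b c d) = mat-cong (l a c) (l b d) (*-identityˡ c) (*-identityˡ d)
    where
    l : ∀ x y → 1 * x + 0 * y ≡ x
    l = solve-∀

  quot-⊗ : ∀ x M N → quot x M ⊗ N ≡ quot x (M ⊗ N)
  quot-⊗ x (mat a b c d) (mat a′ b′ c′ d′) = mat-cong (l x a b c d a′ c′) (l x a b c d b′ d′) refl refl
    where
    l : ∀ x a b c d y z → (x * a + c) * y + (x * b + d) * z ≡ x * (a * y + b * z) + (c * y + d * z)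
    l = solve-∀

  word-++ : ∀ u v → word (u ++ v) ≡ word u ⊗ word v
  word-++ []      v = sym (I-⊗ (word v))
  word-++ (x ∷ u) v = trans (cong (quot x) (word-++ u v)) (sym (quot-⊗ x (word u) (word v)))

  -- An invariant that positive digits preserve, starting from `I`. The corner later serves as a
  -- denominator, and the bottom row makes the comparison of row sums in `quot-rows` strict.
  record Admissible (M : Mat) : Set where
    constructor admissible
    field
      corner : let mat a _ _ _ = M in 0 < a
      bottom : let mat _ _ c d = M in 0 < c + d

  I-admissible : Admissible I
  I-admissible = admissible z<s z<s

  quot-admissible : ∀ {x M} → 0 < x → Admissible M → Admissible (quot x M)
  quot-admissible {suc x} {mat a b c d} _ (admissible 0<a _) = admissible
    (<-≤-trans 0<a (≤-trans (m≤m+n a (x * a)) (m≤m+n _ c)))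
    (<-≤-trans 0<a (m≤m+n a b))

  -- Determinant 1 and -1, with the negative terms moved across so that everything stays in ℕ.
  Det₊ Det₋ : Mat → Set
  Det₊ (mat a b c d) = a * d ≡ 1 + b * c
  Det₋ (mat a b c d) = b * c ≡ 1 + a * d

  quot-det₊ : ∀ x {M} → Det₊ M → Det₋ (quot x M)
  quot-det₊ x {mat a b c d} ad≡1+bc = begin
    (x * b + d) * a         ≡⟨ l₁ x a b d ⟩
    x * a * b + a * d       ≡⟨ cong (x * a * b +_) ad≡1+bc ⟩
    x * a * b + (1 + b * c) ≡⟨ l₂ x a b c ⟩
    1 + (x * a + c) * b     ∎
    where
    open ≡-Reasoning
    l₁ : ∀ x a b d → (x * b + d) * a ≡ x * a * b + a * d
    l₁ = solve-∀
    l₂ : ∀ x a b c → x * a * b + (1 + b * c) ≡ 1 + (x * a + c) * b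
    l₂ = solve-∀

  quot-det₋ : ∀ x {M} → Det₋ M → Det₊ (quot x M)
  quot-det₋ x {mat a b c d} bc≡1+ad = begin
    (x * a + c) * b         ≡⟨ l₁ x a b c ⟩
    x * a * b + b * c       ≡⟨ cong (x * a * b +_) bc≡1+ad ⟩
    x * a * b + (1 + a * d) ≡⟨ l₂ x a b d ⟩
    1 + (x * b + d) * a     ∎
    where
    open ≡-Reasoning
    l₁ : ∀ x a b c → (x * a + c) * b ≡ x * a * b + b * c
    l₁ = solve-∀
    l₂ : ∀ x a b d → x * a * b + (1 + a * d) ≡ 1 + (x * b + d) * a
    l₂ = solve-∀

  word-det : ∀ u → Det₊ (word u) ⊎ Det₋ (word u)
  word-det []      = inj₁ refl
  word-det (x ∷ u) = Sum.swap (Sum.map (quot-det₊ x {word u}) (quot-det₋ x {word u}) (word-det u))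

  -- This is (a d - b c)(a′ d′ - b′ c′) = (-1)(-1). The mixed products a d b′ c′ and b c a′ d′,
  -- negative in the expansion, are added to both sides.
  ⊗-det : ∀ {M N} → Det₋ M → Det₋ N → Det₊ (M ⊗ N)
  ⊗-det {mat a b c d} {mat a′ b′ c′ d′} bc≡1+ad b′c′≡1+a′d′ =
    +-cancelʳ-≡ (a * d * (b′ * c′) + b * c * (a′ * d′)) _ _ (begin
      (a * a′ + b * c′) * (c * b′ + d * d′) + (a * d * (b′ * c′) + b * c * (a′ * d′))
        ≡⟨ l₁ a b c d a′ b′ c′ d′ ⟩
      BC + a * d * (a′ * d′) + b * c * (b′ * c′)
        ≡⟨ cong₂ (λ x y → BC + a * d * (a′ * d′) + x * y) bc≡1+ad b′c′≡1+a′d′ ⟩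
      BC + a * d * (a′ * d′) + (1 + a * d) * (1 + a′ * d′)
        ≡⟨ l₂ BC (a * d) (a′ * d′) ⟩
      1 + BC + (a * d * (1 + a′ * d′) + (1 + a * d) * (a′ * d′))
        ≡⟨ cong₂ (λ x y → 1 + BC + (a * d * y + x * (a′ * d′))) bc≡1+ad b′c′≡1+a′d′ ⟨
      1 + BC + (a * d * (b′ * c′) + b * c * (a′ * d′)) ∎)
    where
    open ≡-Reasoning
    BC = (a * b′ + b * d′) * (c * a′ + d * c′)
    l₁ : ∀ a b c d a′ b′ c′ d′ →
      (a * a′ + b * c′) * (c * b′ + d * d′) + (a * d * (b′ * c′) + b * c * (a′ * d′))
      ≡ (a * b′ + b * d′) * (c * a′ + d * c′) + a * d * (a′ * d′) + b * c * (b′ * c′)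
    l₁ = solve-∀
    l₂ : ∀ z x y → z + x * y + (1 + x) * (1 + y) ≡ 1 + z + (x * (1 + y) + (1 + x) * y)
    l₂ = solve-∀

open Matrices

-- Units and periods

module Units where

  open import Data.Fin.Base using (Fin; toℕ; fromℕ<; combine)
  open import Data.Fin.Properties using (pigeonhole; toℕ-fromℕ<; combine-injective)
  open import Data.List.Properties using (applyUpTo-∷ʳ)
  open import Data.List.Relation.Unary.All as All using (All; []; _∷_)
  open import Data.List.Relation.Unary.All.Properties using (++⁺; applyUpTo⁺₂)
  open import Data.Nat.Base
  open import Data.Nat.Properties
  open import Data.Nat.DivMod using (_/_; _%_; m≡m%n+[m/n]*n; m%n<n; m≥n⇒m/n>0; m/n≤m)
  open import Data.Nat.Tactic.RingSolver using (solve-∀)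

  Digit : ℕ → ℕ → Set
  Digit B x = 1 ≤ x × x ≤ B

  word-admissible : ∀ {B u} → All (Digit B) u → Admissible (word u)
  word-admissible []               = I-admissible
  word-admissible ((1≤x , _) ∷ ds) = quot-admissible 1≤x (word-admissible ds)

  -- With p = f + s e, the matrix of 2s ∷ t is that of multiplication by p + e √δ
  -- in the basis s + √δ, 1.
  record IsUnit (δ s : ℕ) (t : List ℕ) : Set where
    field
      e f h  : ℕ
      word≡  : word t ≡ mat e f f h
      -- The upper right entry 2 s f + h of the matrix has to be e (δ - s²), as (p + e √δ)(s + √δ) =
      -- (p + s e)(s + √δ) + e (δ - s²).
      norm   : h + 2 * s * f + s * s * e ≡ δ * e
      digits : All (Digit (2 * s)) t

    p : ℕ
    p = f + s * e

    0<e : 0 < e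
    0<e = Admissible.corner (subst Admissible word≡ (word-admissible digits))

  Norm1 : ∀ {δ s t} → IsUnit δ s t → Set
  Norm1 {δ} u = p * p ≡ 1 + δ * e * e
    where open IsUnit u

  double : ℕ → List ℕ → List ℕ
  double s t = t ++ 2 * s ∷ t

  x+[1+y] : ∀ x y → x + (1 + y) ≡ 1 + x + y
  x+[1+y] = solve-∀

  module _ {δ s t} (0<s : 0 < s) (u : IsUnit δ s t) where
    open IsUnit u

    double-isUnit : IsUnit δ s (double s t)
    double-isUnit = record
      -- The coefficient of √δ in (p + e √δ)²; `f` and `h` are read off the product of matrices
      -- below.
      { e = 2 * (e * p)
      ; f = e * (2 * s * f + h) + f * f
      ; h = f * (2 * s * f + h) + h * f
      ; word≡ = begin
          word (double s t)                           ≡⟨ word-++ t (2 * s ∷ t) ⟩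
          word t ⊗ quot (2 * s) (word t)              ≡⟨ cong (λ M → M ⊗ quot (2 * s) M) word≡ ⟩
          mat e f f h ⊗ quot (2 * s) (mat e f f h)    ≡⟨ mat-cong (l₁ s e f) refl (l₂ s e f h) refl ⟩
          _ ∎
      ; norm = begin
          _                                           ≡⟨ l₃ s e f h ⟩
          2 * p * (h + 2 * s * f + s * s * e)         ≡⟨ cong (2 * p *_) norm ⟩
          2 * p * (δ * e)                             ≡⟨ l₄ p e δ ⟩
          δ * (2 * (e * p))                           ∎
      ; digits = ++⁺ digits ((*-mono-≤ (s≤s (z≤n {1})) 0<s , ≤-refl) ∷ digits)
      }
      where
      open ≡-Reasoning
      l₁ : ∀ s e f → e * (2 * s * e + f) + f * e ≡ 2 * (e * (f + s * e))
      l₁ = solve-∀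
      l₂ : ∀ s e f h → f * (2 * s * e + f) + h * e ≡ e * (2 * s * f + h) + f * f
      l₂ = solve-∀
      l₃ : ∀ s e f h → f * (2 * s * f + h) + h * f + 2 * s * (e * (2 * s * f + h) + f * f)
        + s * s * (2 * (e * (f + s * e))) ≡ 2 * (f + s * e) * (h + 2 * s * f + s * s * e)
      l₃ = solve-∀
      l₄ : ∀ p e δ → 2 * p * (δ * e) ≡ δ * (2 * (e * p))
      l₄ = solve-∀

    double-p : IsUnit.p double-isUnit ≡ p * p + δ * e * e
    double-p = begin
      e * (2 * s * f + h) + f * f + s * (2 * (e * (f + s * e))) ≡⟨ l s e f h ⟩
      p * p + (h + 2 * s * f + s * s * e) * e                   ≡⟨ cong (λ x → p * p + x * e) norm ⟩
      p * p + δ * e * e                                         ∎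
      where
      open ≡-Reasoning
      l : ∀ s e f h → e * (2 * s * f + h) + f * f + s * (2 * (e * (f + s * e)))
        ≡ (f + s * e) * (f + s * e) + (h + 2 * s * f + s * s * e) * e
      l = solve-∀

    -- The norm of the unit is minus the determinant of `word t`: p² - δ e² = f² - e h. Hence it is
    -- 1 or -1.
    p²-δe² : p * p + e * h ≡ δ * e * e + f * f
    p²-δe² = begin
      (f + s * e) * (f + s * e) + e * h           ≡⟨ l s e f h ⟩
      (h + 2 * s * f + s * s * e) * e + f * f     ≡⟨ cong (λ x → x * e + f * f) norm ⟩
      δ * e * e + f * f                           ∎
      where
      open ≡-Reasoning
      l : ∀ s e f h → (f + s * e) * (f + s * e) + e * h ≡ (h + 2 * s * f + s * s * e) * e + f * f
      l = solve-∀

    norm±1 : p * p ≡ 1 + δ * e * e ⊎ δ * e * e ≡ 1 + p * p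
    norm±1 with subst (λ M → Det₊ M ⊎ Det₋ M) word≡ (word-det t)
    ... | inj₁ eh≡1+ff = inj₂ (+-cancelʳ-≡ (f * f) _ _ (begin
      δ * e * e + f * f       ≡⟨ p²-δe² ⟨
      p * p + e * h           ≡⟨ cong (p * p +_) eh≡1+ff ⟩
      p * p + (1 + f * f)     ≡⟨ x+[1+y] (p * p) (f * f) ⟩
      1 + p * p + f * f       ∎))
      where open ≡-Reasoning
    ... | inj₂ ff≡1+eh = inj₁ (+-cancelʳ-≡ (e * h) _ _ (begin
      p * p + e * h             ≡⟨ p²-δe² ⟩
      δ * e * e + f * f         ≡⟨ cong (δ * e * e +_) ff≡1+eh ⟩
      δ * e * e + (1 + e * h)   ≡⟨ x+[1+y] (δ * e * e) (e * h) ⟩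
      1 + δ * e * e + e * h     ∎))
      where open ≡-Reasoning

    norm1⇒det₋ : Norm1 u → f * f ≡ 1 + e * h
    norm1⇒det₋ p²≡1+δe² = +-cancelˡ-≡ (δ * e * e) _ _ (begin
      δ * e * e + f * f         ≡⟨ p²-δe² ⟨
      p * p + e * h             ≡⟨ cong (_+ e * h) p²≡1+δe² ⟩
      1 + δ * e * e + e * h     ≡⟨ x+[1+y] (δ * e * e) (e * h) ⟨
      δ * e * e + (1 + e * h)   ∎)
      where open ≡-Reasoning

    -- The norm is multiplicative, so a square has norm 1 for either sign. In `square`, x and y
    -- stand for p² and δ e², which differ by 1.
    double-norm1 : Norm1 double-isUnit
    double-norm1 = subst (λ x → x * x ≡ 1 + δ * (2 * (e * p)) * (2 * (e * p))) (sym double-p)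
      (trans (square norm±1) (cong (1 +_) (l δ e p)))
      where
      -- (x + y)² = (x - y)² + 4 x y
      square : ∀ {x y} → x ≡ 1 + y ⊎ y ≡ 1 + x → (x + y) * (x + y) ≡ 1 + 4 * (x * y)
      square {y = y} (inj₁ refl) = m y
        where
        m : ∀ y → (1 + y + y) * (1 + y + y) ≡ 1 + 4 * ((1 + y) * y)
        m = solve-∀
      square {x} (inj₂ refl) = m x
        where
        m : ∀ x → (x + (1 + x)) * (x + (1 + x)) ≡ 1 + 4 * (x * (1 + x))
        m = solve-∀
      l : ∀ δ e p → 4 * (p * p * (δ * e * e)) ≡ δ * (2 * (e * p)) * (2 * (e * p))
      l = solve-∀

    -- Cleared of denominators, e / p < 2 e p / (p² + δ e²); this amounts to δ e² < p², which norm 1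
    -- provides.
    double-ratio : Norm1 u → e * IsUnit.p double-isUnit < 2 * (e * p) * p
    double-ratio p²≡1+δe² = begin-strict
      e * IsUnit.p double-isUnit ≡⟨ cong (e *_) double-p ⟩
      e * (p * p + δ * e * e)    <⟨ *-monoʳ-< e (+-monoʳ-< (p * p) (subst (δ * e * e <_) (sym p²≡1+δe²) (n<1+n _))) ⟩
      e * (p * p + p * p)        ≡⟨ l e p ⟩
      2 * (e * p) * p            ∎
      where
      open ≤-Reasoning
      instance _ = >-nonZero 0<e
      l : ∀ e p → e * (p * p + p * p) ≡ 2 * (e * p) * p
      l = solve-∀

  -- Reduced quadratic irrationals and the period of s + √δ

  module Reduction (δ s : ℕ) (s²<δ : s * s < δ) (δ<[1+s]² : δ < suc s * suc s) where

    -- If x ≤ s - p then p² + x y ≤ p² + (s - p) (p + s) = s².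
    s<p+x : ∀ {p x y} → p ≤ s → y ≤ p + s → p * p + x * y ≡ δ → s < p + x
    s<p+x {p} {x} {y} p≤s y≤p+s eq = ≰⇒> λ p+x≤s → <-irrefl refl (begin-strict
      δ                           ≡⟨ eq ⟨
      p * p + x * y               ≤⟨ +-monoʳ-≤ (p * p) (*-mono-≤ (+-cancelˡ-≤ p x (s ∸ p) (subst (p + x ≤_) (sym p+r≡s) p+x≤s)) y≤p+s) ⟩
      p * p + (s ∸ p) * (p + s)   ≡⟨ cong (λ t → p * p + (s ∸ p) * (p + t)) p+r≡s ⟨
      p * p + (s ∸ p) * (p + (p + (s ∸ p))) ≡⟨ l p (s ∸ p) ⟩
      (p + (s ∸ p)) * (p + (s ∸ p)) ≡⟨ cong (λ t → t * t) p+r≡s ⟩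
      s * s                       <⟨ s²<δ ⟩
      δ                           ∎)
      where
      open ≤-Reasoning
      p+r≡s : p + (s ∸ p) ≡ s
      p+r≡s = m+[n∸m]≡n p≤s
      l : ∀ p r → p * p + r * (p + (p + r)) ≡ (p + r) * (p + r)
      l = solve-∀

    -- The reduced quadratic irrational (p + √δ) / q, with o = (δ - p²) / q.
    record Reduced : Set where
      field
        o p q : ℕ
        norm  : p * p + o * q ≡ δ
        -- With s in place of √δ, the first two bounds put the conjugate (p - √δ) / q between -1 and
        -- 0, and the third makes (p + √δ) / q exceed 1.
        p≤s   : p ≤ s
        s<p+q : s < p + q
        q≤p+s : q ≤ p + s

      0<q : 0 < q
      0<q = +-cancelˡ-< p 0 q (≤-<-trans (subst (_≤ s) (sym (+-identityʳ p)) p≤s) s<p+q)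

    open Reduced

    -- (p + √δ) / q = a + q′ / (p′ + √δ)
    record Step (σ : Reduced) (a : ℕ) (τ : Reduced) : Set where
      field
        digit : Digit (2 * s) a
        p+p′  : p σ + p τ ≡ a * q σ
        o′    : o τ ≡ q σ
        q′    : q τ + a * p τ ≡ o σ + a * p σ

    successor : ∀ σ → ∃[ a ] Σ[ τ ∈ Reduced ] Step σ a τ
    successor σ = a , τ , record { digit = 1≤a , a≤2s ; p+p′ = p+p′≡aq ; o′ = refl ; q′ = q″+ap′ }
      where
      instance _ = >-nonZero (0<q σ)
      p₀ = p σ
      q₀ = q σ
      o₀ = o σ
      -- This is ⌊(p + √δ) / q⌋, since replacing √δ by s does not change the floor. From p + s = r +
      -- a q the next p′ = a q - p is s - r.
      a = (p₀ + s) / q₀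
      r = (p₀ + s) % q₀
      p′ = s ∸ r

      p+s≡r+aq : p₀ + s ≡ r + a * q₀
      p+s≡r+aq = m≡m%n+[m/n]*n (p₀ + s) q₀

      1≤a : 1 ≤ a
      1≤a = m≥n⇒m/n>0 (q≤p+s σ)

      q≤aq : q₀ ≤ a * q₀
      q≤aq = m≤n*m q₀ a {{>-nonZero 1≤a}}

      a≤2s : a ≤ 2 * s
      a≤2s = ≤-trans (m/n≤m (p₀ + s) q₀) (≤-trans (+-monoˡ-≤ s (p≤s σ)) (≤-reflexive (cong (s +_) (sym (+-identityʳ s)))))

      -- This makes r ≤ s, so that the truncated difference s ∸ r is exact. A large q exceeds p
      -- already; a small one bounds r by s.
      p≤aq : p₀ ≤ a * q₀
      p≤aq with q₀ ≤? s
      ... | no q≰s = ≤-trans (p≤s σ) (≤-trans (<⇒≤ (≰⇒> q≰s)) q≤aq)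
      ... | yes q≤s = +-cancelˡ-≤ s p₀ (a * q₀) (begin
        s + p₀       ≡⟨ +-comm s p₀ ⟩
        p₀ + s       ≡⟨ p+s≡r+aq ⟩
        r + a * q₀   ≤⟨ +-monoˡ-≤ (a * q₀) (≤-trans (<⇒≤ (m%n<n (p₀ + s) q₀)) q≤s) ⟩
        s + a * q₀   ∎)
        where open ≤-Reasoning

      r≤s : r ≤ s
      r≤s = +-cancelʳ-≤ p₀ r s (begin
        r + p₀       ≤⟨ +-monoʳ-≤ r p≤aq ⟩
        r + a * q₀   ≡⟨ p+s≡r+aq ⟨
        p₀ + s       ≡⟨ +-comm p₀ s ⟩
        s + p₀       ∎)
        where open ≤-Reasoning

      p′+r≡s : p′ + r ≡ s
      p′+r≡s = m∸n+n≡m r≤s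

      p+p′≡aq : p₀ + p′ ≡ a * q₀
      p+p′≡aq = +-cancelʳ-≡ r _ _ (begin
        p₀ + p′ + r     ≡⟨ +-assoc p₀ p′ r ⟩
        p₀ + (p′ + r)   ≡⟨ cong (p₀ +_) p′+r≡s ⟩
        p₀ + s          ≡⟨ p+s≡r+aq ⟩
        r + a * q₀      ≡⟨ +-comm r _ ⟩
        a * q₀ + r      ∎)
        where open ≡-Reasoning

      p′≤s : p′ ≤ s
      p′≤s = m∸n≤m s r

      p′²≤δ : p′ * p′ ≤ δ
      p′²≤δ = ≤-trans (*-mono-≤ p′≤s p′≤s) (<⇒≤ s²<δ)

      -- q₀ q″ = δ - p′², so q₀ (a p′) ≤ q₀ (o + a p)
      ap′≤o+ap : a * p′ ≤ o₀ + a * p₀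
      ap′≤o+ap = *-cancelˡ-≤ q₀ (+-cancelʳ-≤ (p′ * p′) _ _ (begin
        q₀ * (a * p′) + p′ * p′           ≡⟨ cong (_+ p′ * p′) (l₁ q₀ a p′) ⟩
        (a * q₀) * p′ + p′ * p′           ≡⟨ cong (λ x → x * p′ + p′ * p′) p+p′≡aq ⟨
        (p₀ + p′) * p′ + p′ * p′          ≤⟨ +-monoʳ-≤ _ p′²≤δ ⟩
        (p₀ + p′) * p′ + δ                ≡⟨ cong ((p₀ + p′) * p′ +_) (norm σ) ⟨
        (p₀ + p′) * p′ + (p₀ * p₀ + o₀ * q₀)  ≡⟨ l₂ p₀ p′ o₀ q₀ ⟩
        o₀ * q₀ + (p₀ + p′) * p₀ + p′ * p′    ≡⟨ cong (λ x → o₀ * q₀ + x * p₀ + p′ * p′) p+p′≡aq ⟩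
        o₀ * q₀ + a * q₀ * p₀ + p′ * p′       ≡⟨ l₃ q₀ a p₀ o₀ p′ ⟩
        q₀ * (o₀ + a * p₀) + p′ * p′      ∎))
        where
        open ≤-Reasoning
        l₁ : ∀ q a p → q * (a * p) ≡ a * q * p
        l₁ = solve-∀
        l₂ : ∀ p p′ o q → (p + p′) * p′ + (p * p + o * q) ≡ o * q + (p + p′) * p + p′ * p′
        l₂ = solve-∀
        l₃ : ∀ q a p o p′ → o * q + a * q * p + p′ * p′ ≡ q * (o + a * p) + p′ * p′
        l₃ = solve-∀

      q″ = (o₀ + a * p₀) ∸ a * p′

      q″+ap′ : q″ + a * p′ ≡ o₀ + a * p₀
      q″+ap′ = m∸n+n≡m ap′≤o+ap

      norm′ : p′ * p′ + q₀ * q″ ≡ δ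
      norm′ = +-cancelʳ-≡ (a * q₀ * p′) _ _ (begin
        p′ * p′ + q₀ * q″ + a * q₀ * p′     ≡⟨ l₁ p′ q₀ q″ a ⟩
        p′ * p′ + q₀ * (q″ + a * p′)        ≡⟨ cong (λ x → p′ * p′ + q₀ * x) q″+ap′ ⟩
        p′ * p′ + q₀ * (o₀ + a * p₀)        ≡⟨ l₂ p′ q₀ o₀ a p₀ ⟩
        p′ * p′ + a * q₀ * p₀ + o₀ * q₀     ≡⟨ cong (λ x → p′ * p′ + x * p₀ + o₀ * q₀) p+p′≡aq ⟨
        p′ * p′ + (p₀ + p′) * p₀ + o₀ * q₀  ≡⟨ l₃ p′ p₀ o₀ q₀ ⟩
        p₀ * p₀ + o₀ * q₀ + (p₀ + p′) * p′  ≡⟨ cong₂ (λ x y → x + y * p′) (norm σ) p+p′≡aq ⟩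
        δ + a * q₀ * p′                     ∎)
        where
        open ≡-Reasoning
        l₁ : ∀ p′ q q″ a → p′ * p′ + q * q″ + a * q * p′ ≡ p′ * p′ + q * (q″ + a * p′)
        l₁ = solve-∀
        l₂ : ∀ p′ q o a p → p′ * p′ + q * (o + a * p) ≡ p′ * p′ + a * q * p + o * q
        l₂ = solve-∀
        l₃ : ∀ p′ p o q → p′ * p′ + (p + p′) * p + o * q ≡ p * p + o * q + (p + p′) * p′
        l₃ = solve-∀

      -- δ - p′² < (1 + s - p′) (1 + s + p′) ≤ q₀ (1 + s + p′)
      q″≤p′+s : q″ ≤ p′ + s
      q″≤p′+s = s≤s⁻¹ (*-cancelˡ-< q₀ q″ (suc (p′ + s)) (+-cancelˡ-< (p′ * p′) _ _ (begin-strict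
        p′ * p′ + q₀ * q″                    ≡⟨ norm′ ⟩
        δ                                    <⟨ δ<[1+s]² ⟩
        suc s * suc s                        ≡⟨ cong (λ x → suc x * suc x) p′+r≡s ⟨
        suc (p′ + r) * suc (p′ + r)          ≡⟨ l p′ r ⟩
        p′ * p′ + suc r * suc (p′ + (p′ + r)) ≤⟨ +-monoʳ-≤ (p′ * p′) (*-monoˡ-≤ (suc (p′ + (p′ + r))) (m%n<n (p₀ + s) q₀)) ⟩
        p′ * p′ + q₀ * suc (p′ + (p′ + r))   ≡⟨ cong (λ x → p′ * p′ + q₀ * suc (p′ + x)) p′+r≡s ⟩
        p′ * p′ + q₀ * suc (p′ + s)          ∎)))
        where
        open ≤-Reasoning
        l : ∀ p r → suc (p + r) * suc (p + r) ≡ p * p + suc r * suc (p + (p + r))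
        l = solve-∀

      s<p′+q″ : s < p′ + q″
      s<p′+q″ = s<p+x p′≤s q≤p′+s (trans (cong (p′ * p′ +_) (*-comm q″ q₀)) norm′)
        where
        open ≤-Reasoning
        q≤p′+s : q₀ ≤ p′ + s
        q≤p′+s = begin
          q₀       ≤⟨ q≤aq ⟩
          a * q₀   ≡⟨ p+p′≡aq ⟨
          p₀ + p′  ≡⟨ +-comm p₀ p′ ⟩
          p′ + p₀  ≤⟨ +-monoʳ-≤ p′ (p≤s σ) ⟩
          p′ + s   ∎

      τ : Reduced
      τ = record { o = q₀ ; p = p′ ; q = q″ ; norm = norm′ ; p≤s = p′≤s ; s<p+q = s<p′+q″ ; q≤p+s = q″≤p′+s }

    abstract
      step : ∀ σ → ∃[ a ] Σ[ τ ∈ Reduced ] Step σ a τ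
      step = successor

    -- o need not be compared, since p and q determine it.
    infix 4 _≈_
    _≈_ : Reduced → Reduced → Set
    σ ≈ τ = p σ ≡ p τ × q σ ≡ q τ

    ≈⇒o≡ : ∀ σ τ → σ ≈ τ → o σ ≡ o τ
    ≈⇒o≡ σ τ (pσ≡pτ , qσ≡qτ) = *-cancelʳ-≡ (o σ) (o τ) (q τ) {{>-nonZero (0<q τ)}}
      (+-cancelˡ-≡ (p τ * p τ) _ _ (begin
        p τ * p τ + o σ * q τ   ≡⟨ cong₂ (λ x y → x * x + o σ * y) pσ≡pτ qσ≡qτ ⟨
        p σ * p σ + o σ * q σ   ≡⟨ norm σ ⟩
        δ                       ≡⟨ norm τ ⟨
        p τ * p τ + o τ * q τ   ∎))
      where open ≡-Reasoning

    -- a is determined by its successor, as the preceding p lies in (s - q, s] and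
    -- is congruent to - p′ modulo q.
    step-digit-≤ : ∀ {σ₁ σ₂ a₁ a₂ τ₁ τ₂} → Step σ₁ a₁ τ₁ → Step σ₂ a₂ τ₂ → τ₁ ≈ τ₂ → a₁ ≤ a₂
    step-digit-≤ {σ₁} {σ₂} {a₁} {a₂} {τ₁} {τ₂} S₁ S₂ τ₁≈τ₂ = ≮⇒≥ λ a₂<a₁ →
      <⇒≱ (s<p+q σ₂) (+-cancelʳ-≤ (p τ₂) _ _ (begin
        p σ₂ + q σ₂ + p τ₂     ≡⟨ l (p σ₂) (q σ₂) (p τ₂) ⟩
        q σ₂ + (p σ₂ + p τ₂)   ≡⟨ cong (q σ₂ +_) (Step.p+p′ S₂) ⟩
        suc a₂ * q σ₂          ≤⟨ *-monoˡ-≤ (q σ₂) a₂<a₁ ⟩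
        a₁ * q σ₂              ≡⟨ cong (a₁ *_) q₁≡q₂ ⟨
        a₁ * q σ₁              ≡⟨ Step.p+p′ S₁ ⟨
        p σ₁ + p τ₁            ≤⟨ +-mono-≤ (p≤s σ₁) (≤-reflexive (proj₁ τ₁≈τ₂)) ⟩
        s + p τ₂               ∎))
      where
      open ≤-Reasoning
      q₁≡q₂ : q σ₁ ≡ q σ₂
      q₁≡q₂ = trans (sym (Step.o′ S₁)) (trans (≈⇒o≡ τ₁ τ₂ τ₁≈τ₂) (Step.o′ S₂))
      l : ∀ x y z → x + y + z ≡ y + (x + z)
      l = solve-∀

    -- The preceding q is the o of the successor, which the successor's p and q determine; with
    -- equal digits, p = a q - p′ then agrees too.
    step-injective : ∀ {σ₁ σ₂ a₁ a₂ τ₁ τ₂} → Step σ₁ a₁ τ₁ → Step σ₂ a₂ τ₂ → τ₁ ≈ τ₂ → σ₁ ≈ σ₂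
    step-injective {σ₁} {σ₂} {a₁} {a₂} {τ₁} {τ₂} S₁ S₂ τ₁≈τ₂@(p₁≡p₂ , q₁≡q₂) =
      +-cancelʳ-≡ (p τ₂) _ _ (begin
        p σ₁ + p τ₂   ≡⟨ cong (p σ₁ +_) p₁≡p₂ ⟨
        p σ₁ + p τ₁   ≡⟨ Step.p+p′ S₁ ⟩
        a₁ * q σ₁     ≡⟨ cong₂ _*_ a₁≡a₂ qσ₁≡qσ₂ ⟩
        a₂ * q σ₂     ≡⟨ Step.p+p′ S₂ ⟨
        p σ₂ + p τ₂   ∎) , qσ₁≡qσ₂
      where
      open ≡-Reasoning
      qσ₁≡qσ₂ : q σ₁ ≡ q σ₂
      qσ₁≡qσ₂ = trans (sym (Step.o′ S₁)) (trans (≈⇒o≡ τ₁ τ₂ τ₁≈τ₂) (Step.o′ S₂))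
      a₁≡a₂ : a₁ ≡ a₂
      a₁≡a₂ = ≤-antisym (step-digit-≤ S₁ S₂ τ₁≈τ₂) (step-digit-≤ S₂ S₁ (sym p₁≡p₂ , sym q₁≡q₂))

    module _ (0<s : 0 < s) where

      -- s + √δ
      start : Reduced
      start = record
        { o     = δ ∸ s * s
        ; p     = s
        ; q     = 1
        ; norm  = trans (cong (s * s +_) (*-identityʳ _)) (m+[n∸m]≡n (<⇒≤ s²<δ))
        ; p≤s   = ≤-refl
        ; s<p+q = m<m+n s z<s
        ; q≤p+s = ≤-trans 0<s (m≤m+n s s)
        }

      orbit : ℕ → Reduced
      orbit zero    = start
      orbit (suc k) = proj₁ (proj₂ (step (orbit k)))

      digitAt : ℕ → ℕ
      digitAt k = proj₁ (step (orbit k))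

      orbit-step : ∀ k → Step (orbit k) (digitAt k) (orbit (suc k))
      orbit-step k = proj₂ (proj₂ (step (orbit k)))

      -- A coincidence anywhere in the orbit is pulled back step by step to the start, so the orbit
      -- is periodic without preperiod.
      orbit-injective : ∀ m k → orbit m ≈ orbit (m + k) → orbit 0 ≈ orbit k
      orbit-injective zero    k eq = eq
      orbit-injective (suc m) k eq = orbit-injective m k (step-injective (orbit-step m) (orbit-step (m + k)) eq)

      -- The bounds p ≤ s and q ≤ p + s ≤ 2 s leave finitely many pairs (p , q), to which the
      -- pigeonhole principle applies.
      code : Reduced → Fin (suc s * suc (s + s))
      code σ = combine (fromℕ< (s≤s (p≤s σ))) (fromℕ< (s≤s (≤-trans (q≤p+s σ) (+-monoˡ-≤ s (p≤s σ)))))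

      code-injective : ∀ σ τ → code σ ≡ code τ → σ ≈ τ
      code-injective σ τ eq with p≡ , q≡ ← combine-injective (fromℕ< (s≤s (p≤s σ))) _ (fromℕ< (s≤s (p≤s τ))) _ eq =
        trans (sym (toℕ-fromℕ< _)) (trans (cong toℕ p≡) (toℕ-fromℕ< _)) ,
        trans (sym (toℕ-fromℕ< _)) (trans (cong toℕ q≡) (toℕ-fromℕ< _))

      returns : ∃[ k ] orbit 0 ≈ orbit (suc k)
      returns with i , j , i<j , eq ← pigeonhole (n<1+n _) (λ (i : Fin (suc (suc s * suc (s + s)))) → code (orbit (toℕ i)))
              with k , 1+i+k≡j ← m≤n⇒∃[o]m+o≡n i<j
        = k , orbit-injective (toℕ i) (suc k) (subst (λ j → orbit (toℕ i) ≈ orbit j)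
                (sym (trans (+-suc (toℕ i) k) 1+i+k≡j)) (code-injective (orbit (toℕ i)) (orbit (toℕ j)) eq))

      head≡2s : digitAt 0 ≡ 2 * s
      head≡2s = begin
        digitAt 0                ≡⟨ *-identityʳ _ ⟨
        digitAt 0 * 1            ≡⟨ Step.p+p′ (orbit-step 0) ⟨
        s + p (orbit 1)          ≡⟨ cong (s +_) (≤-antisym (p≤s (orbit 1)) s≤p) ⟩
        s + s                    ≡⟨ cong (s +_) (+-identityʳ s) ⟨
        2 * s                    ∎
        where
        open ≡-Reasoning
        -- The o of the second term is the q of the start, namely 1, so `s<p+x` with x = o reads s <
        -- p + 1.
        s≤p : s ≤ p (orbit 1)
        s≤p = s≤s⁻¹ (subst (s <_) (+-comm (p (orbit 1)) 1)
          (subst (λ x → s < p (orbit 1) + x) (Step.o′ (orbit-step 0))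
            (s<p+x (p≤s (orbit 1)) (q≤p+s (orbit 1)) (norm (orbit 1)))))

      -- The lower row of S₀ W = W S, where S = [[p,o],[q,-p]] describes multiplication
      -- by √δ in the basis (p + √δ) / q, 1, and S₀ is its value at the start.
      Intertwines : Mat → Reduced → Set
      Intertwines (mat a b c d) σ = a ≡ c * p σ + d * q σ + s * c × b + d * p σ ≡ c * o σ + s * d

      -- With Q = [[x,1],[1,0]], the equations of `Step` say S Q = Q S′ for the matrices S and S′ of
      -- `σ` and `τ`. Hence S₀ W = W S yields S₀ (W Q) = (W Q) S′.
      intertwines-step : ∀ {W σ x τ} → Step σ x τ → Intertwines W σ → Intertwines (W ⊗ quot x I) τ
      intertwines-step {mat a b c d} {σ} {x} {τ} S (eq₁ , eq₂) = +-cancelʳ-≡ (d * p σ) _ _ (begin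
        a * (x * 1 + 0) + b * 1 + d * p σ                               ≡⟨ l₁ a x b (d * p σ) ⟩
        x * a + (b + d * p σ)                                           ≡⟨ cong₂ (λ y z → x * y + z) eq₁ eq₂ ⟩
        x * (c * p σ + d * q σ + s * c) + (c * o σ + s * d)             ≡⟨ l₂ x c (p σ) d (q σ) s (o σ) ⟩
        c * (o σ + x * p σ) + d * (x * q σ) + s * (c * x + d)           ≡⟨ cong₂ (λ y z → c * y + d * z + s * (c * x + d)) (Step.q′ S) (Step.p+p′ S) ⟨
        c * (q τ + x * p τ) + d * (p σ + p τ) + s * (c * x + d)         ≡⟨ l₃ c (q τ) x (p τ) d (p σ) s ⟩
        (c * (x * 1 + 0) + d * 1) * p τ + (c * (x * 0 + 1) + d * 0) * q τ + s * (c * (x * 1 + 0) + d * 1) + d * p σ ∎)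
        , (begin
        a * (x * 0 + 1) + b * 0 + (c * (x * 0 + 1) + d * 0) * p τ       ≡⟨ l₄ a x b c d (p τ) ⟩
        a + c * p τ                                                     ≡⟨ cong (_+ c * p τ) eq₁ ⟩
        c * p σ + d * q σ + s * c + c * p τ                             ≡⟨ l₅ c (p σ) d (q σ) s (p τ) ⟩
        c * (p σ + p τ) + d * q σ + s * c                               ≡⟨ cong (λ y → c * y + d * q σ + s * c) (Step.p+p′ S) ⟩
        c * (x * q σ) + d * q σ + s * c                                 ≡⟨ l₆ c x (q σ) d s ⟩
        (c * (x * 1 + 0) + d * 1) * q σ + s * (c * (x * 0 + 1) + d * 0) ≡⟨ cong (λ y → (c * (x * 1 + 0) + d * 1) * y + s * (c * (x * 0 + 1) + d * 0)) (Step.o′ S) ⟨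
        (c * (x * 1 + 0) + d * 1) * o τ + s * (c * (x * 0 + 1) + d * 0) ∎)
        where
        open ≡-Reasoning
        l₁ : ∀ a x b y → a * (x * 1 + 0) + b * 1 + y ≡ x * a + (b + y)
        l₁ = solve-∀
        l₂ : ∀ x c p d q s o → x * (c * p + d * q + s * c) + (c * o + s * d)
          ≡ c * (o + x * p) + d * (x * q) + s * (c * x + d)
        l₂ = solve-∀
        l₃ : ∀ c q x p′ d p s → c * (q + x * p′) + d * (p + p′) + s * (c * x + d)
          ≡ (c * (x * 1 + 0) + d * 1) * p′ + (c * (x * 0 + 1) + d * 0) * q + s * (c * (x * 1 + 0) + d * 1) + d * p
        l₃ = solve-∀
        l₄ : ∀ a x b c d p → a * (x * 0 + 1) + b * 0 + (c * (x * 0 + 1) + d * 0) * p ≡ a + c * p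
        l₄ = solve-∀
        l₅ : ∀ c p d q s p′ → c * p + d * q + s * c + c * p′ ≡ c * (p + p′) + d * q + s * c
        l₅ = solve-∀
        l₆ : ∀ c x q d s → c * (x * q) + d * q + s * c
          ≡ (c * (x * 1 + 0) + d * 1) * q + s * (c * (x * 0 + 1) + d * 0)
        l₆ = solve-∀

      intertwines-orbit : ∀ k → Intertwines (word (applyUpTo digitAt k)) (orbit k)
      intertwines-orbit zero    = sym (cong suc (*-zeroʳ s)) , trans (*-identityˡ s) (sym (*-identityʳ s))
      intertwines-orbit (suc k) = subst (λ W → Intertwines W (orbit (suc k)))
        (trans (sym (word-++ (applyUpTo digitAt k) _)) (cong word (applyUpTo-∷ʳ digitAt k)))
        (intertwines-step (orbit-step k) (intertwines-orbit k))

      -- Once the orbit returns, the matrix of the period commutes with S₀, multiplication by √δ, so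
      -- it is itself multiplication by an element of ℚ(√δ). Its first equation makes `word t`
      -- symmetric, and the second gives 2 s f + h = e (δ - s²).
      period-unit : ∀ k → orbit 0 ≈ orbit (suc k) → IsUnit δ s (applyUpTo (λ i → digitAt (suc i)) k)
      period-unit k τ≈ = record
        { e      = e
        ; f      = f
        ; h      = h
        ; word≡  = cong (λ x → mat e f x h) g≡f
        ; norm   = trans (cong (_+ s * s * e) h+2sf≡eo) (begin
            e * o start + s * s * e     ≡⟨ l₁ e (o start) s ⟩
            (s * s + o start * 1) * e   ≡⟨ cong (_* e) (norm start) ⟩
            δ * e                       ∎)
        ; digits = applyUpTo⁺₂ _ k (λ i → Step.digit (orbit-step (suc i)))
        }
        where
        open ≡-Reasoning
        t = applyUpTo (λ i → digitAt (suc i)) k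
        open Mat (word t) renaming (a₁₁ to e; a₁₂ to f; a₂₁ to g; a₂₂ to h)

        raw : Intertwines (quot (2 * s) (word t)) (orbit (suc k))
        raw = subst (λ x → Intertwines (quot x (word t)) (orbit (suc k))) head≡2s (intertwines-orbit (suc k))

        returned : Intertwines (quot (2 * s) (word t)) start
        returned =
          trans (proj₁ raw) (cong₂ (λ x y → e * x + f * y + s * e) (sym (proj₁ τ≈)) (sym (proj₂ τ≈))) ,
          trans (cong (λ x → 2 * s * f + h + f * x) (proj₁ τ≈))
            (trans (proj₂ raw) (cong (λ x → e * x + s * f) (sym (≈⇒o≡ start (orbit (suc k)) τ≈))))

        g≡f : g ≡ f
        g≡f = +-cancelˡ-≡ (2 * s * e) _ _ (trans (proj₁ returned) (l e s f))
          where
          l : ∀ e s f → e * s + f * 1 + s * e ≡ 2 * s * e + f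
          l = solve-∀

        h+2sf≡eo : h + 2 * s * f ≡ e * o start
        h+2sf≡eo = +-cancelʳ-≡ (s * f) _ _ (trans (l s f h) (proj₂ returned))
          where
          l : ∀ s f h → h + 2 * s * f + s * f ≡ 2 * s * f + h + f * s
          l = solve-∀

        l₁ : ∀ e o s → e * o + s * s * e ≡ (s * s + o * 1) * e
        l₁ = solve-∀

      unit : ∃[ t ] IsUnit δ s t
      unit = period returns
        where
        period : (∃[ k ] orbit 0 ≈ orbit (suc k)) → ∃[ t ] IsUnit δ s t
        period (k , τ≈) = applyUpTo (λ i → digitAt (suc i)) k , period-unit k τ≈

  -- Twisted periods: digits, lower left entry and discriminant

  -- The word 1, z, c, r, where [1, 0, c] = [1 + c].
  join : ℕ → ℕ → List ℕ → List ℕ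
  join zero    c r = suc c ∷ r
  join (suc z) c r = 1 ∷ suc z ∷ c ∷ r

  word-join : ∀ z c r → word (join z c r) ≡ word (1 ∷ z ∷ c ∷ r)
  word-join (suc z) c r = refl
  word-join zero    c r = mat-cong (l c (Mat.a₁₁ (word r)) _) (l c (Mat.a₁₂ (word r)) _) refl refl
    where
    l : ∀ c x y → suc c * x + y ≡ 1 * (0 * (c * x + y) + x) + (c * x + y)
    l = solve-∀

  join-digits : ∀ {B z c r} → 1 ≤ B → z ≤ B → suc c ≤ B → All (Digit B) (c ∷ r) → All (Digit B) (join z c r)
  join-digits {z = zero}  _   _   c<B (_ ∷ ds) = (s≤s z≤n , c<B) ∷ ds
  join-digits {z = suc z} 1≤B z≤B _   ds       = (≤-refl , 1≤B) ∷ (s≤s z≤n , z≤B) ∷ ds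

  quot₁₁ : ∀ a b c d → quot 1 (quot 1 (mat a b c d)) ≡ mat (2 * a + c) (2 * b + d) (a + c) (b + d)
  quot₁₁ a b c d = mat-cong (l₁ a c) (l₁ b d) (l₂ a c) (l₂ b d)
    where
    l₁ : ∀ a c → 1 * (1 * a + c) + a ≡ 2 * a + c
    l₁ = solve-∀
    l₂ : ∀ a c → 1 * a + c ≡ a + c
    l₂ = solve-∀

  module _ (s′ : ℕ) where
    private
      s = suc s′

    -- If M is the matrix of t then twist M is that of s, 1, 1, s - 1, t, which describes
    -- X U in the basis s + √δ, 1.
    twist : Mat → Mat
    twist M = quot s (quot 1 (quot 1 (quot s′ M)))

    twist-mat : ∀ a b c d → twist (mat a b c d) ≡ mat (2 * s * s * a + (1 + 2 * s) * c) (2 * s * s * b + (1 + 2 * s) * d)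
                                                      ((1 + 2 * s′) * a + 2 * c) ((1 + 2 * s′) * b + 2 * d)
    twist-mat a b c d = mat-cong (l₁ s′ a c) (l₁ s′ b d) (l₂ s′ a c) (l₂ s′ b d)
      where
      l₁ : ∀ s′ a c → suc s′ * (1 * (1 * (s′ * a + c) + a) + (s′ * a + c)) + (1 * (s′ * a + c) + a)
        ≡ 2 * suc s′ * suc s′ * a + (1 + 2 * suc s′) * c
      l₁ = solve-∀
      l₂ : ∀ s′ a c → 1 * (1 * (s′ * a + c) + a) + (s′ * a + c) ≡ (1 + 2 * s′) * a + 2 * c
      l₂ = solve-∀

    module _ (u w h : ℕ) where
      private
        -- If t has the matrix [[e,f],[f,h]], lowering its first digit by 1 subtracts the lower row
        -- from the upper one and gives [[u,w],[f,h]]. So `V` belongs to 1, 1, t with its first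
        -- digit lowered, s, 1, 1, s - 1, t.
        f = w + h
        e = u + f
        p = f + s * e
        V = quot 1 (quot 1 (mat u w f h)) ⊗ twist (mat e f f h)

      twisted : V ≡ mat (2 * u + f) (2 * w + h) (u + f) (w + h)
                  ⊗ mat (2 * s * s * e + (1 + 2 * s) * f) (2 * s * s * f + (1 + 2 * s) * h)
                        ((1 + 2 * s′) * e + 2 * f) ((1 + 2 * s′) * f + 2 * h)
      twisted = cong₂ _⊗_ (quot₁₁ u w f h) (twist-mat e f f h)

      -- Conjugation by [[1,s],[0,1]] keeps the lower left entry, which for Y U X U is e p + p (2 p
      -- - e).
      twisted-corner : Mat.a₂₁ V ≡ 2 * (p * p)
      twisted-corner = trans (cong Mat.a₂₁ twisted) (l s′ e f)
        where
        l : ∀ s′ e f → e * (2 * suc s′ * suc s′ * e + (1 + 2 * suc s′) * f) + f * ((1 + 2 * s′) * e + 2 * f)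
          ≡ 2 * ((f + suc s′ * e) * (f + suc s′ * e))
        l = solve-∀

      -- The inner bracket is δ e by the norm equation, so this is the trace 2 (p² + δ e²) of U².
      twisted-trace : Mat.a₁₁ V + Mat.a₂₂ V ≡ 2 * (p * p + (h + 2 * s * f + s * s * e) * e)
      twisted-trace = trans (cong (λ M → Mat.a₁₁ M + Mat.a₂₂ M) twisted) (l s′ u w h)
        where
        l : ∀ s′ u w h →
          (2 * u + (w + h)) * (2 * suc s′ * suc s′ * (u + (w + h)) + (1 + 2 * suc s′) * (w + h))
          + (2 * w + h) * ((1 + 2 * s′) * (u + (w + h)) + 2 * (w + h))
          + ((u + (w + h)) * (2 * suc s′ * suc s′ * (w + h) + (1 + 2 * suc s′) * h)
          + (w + h) * ((1 + 2 * s′) * (w + h) + 2 * h))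
          ≡ 2 * ((w + h + suc s′ * (u + (w + h))) * (w + h + suc s′ * (u + (w + h)))
          + (h + 2 * suc s′ * (w + h) + suc s′ * suc s′ * (u + (w + h))) * (u + (w + h)))
        l = solve-∀

      -- Lowering a digit keeps the determinant -1, and each `quot` changes its sign: twice in the
      -- left factor and four times in the right one. So both factors of `V` have determinant -1.
      twisted-det : f * f ≡ 1 + e * h → Det₊ V
      twisted-det ff≡1+eh = ⊗-det
        {quot 1 (quot 1 (mat u w f h))} {twist (mat e f f h)}
        (quot-det₊ 1 {quot 1 (mat u w f h)} (quot-det₋ 1 {mat u w f h} wf≡1+uh))
        (quot-det₊ s {quot 1 (quot 1 (quot s′ (mat e f f h)))} (quot-det₋ 1 {quot 1 (quot s′ (mat e f f h))}
          (quot-det₊ 1 {quot s′ (mat e f f h)} (quot-det₋ s′ {mat e f f h} ff≡1+eh))))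
        where
        wf≡1+uh : w * f ≡ 1 + u * h
        wf≡1+uh = +-cancelʳ-≡ (f * h) _ _ (begin
          w * f + f * h       ≡⟨ l₁ w h ⟩
          f * f               ≡⟨ ff≡1+eh ⟩
          1 + e * h           ≡⟨ l₂ u f h ⟩
          1 + u * h + f * h   ∎)
          where
          open ≡-Reasoning
          l₁ : ∀ w h → w * (w + h) + (w + h) * h ≡ (w + h) * (w + h)
          l₁ = solve-∀
          l₂ : ∀ u f h → 1 + (u + f) * h ≡ 1 + u * h + f * h
          l₂ = solve-∀

  -- The discriminant of the fixed-point equation of M is δ R².
  Disc : ℕ → ℕ → Mat → Set
  Disc δ R (mat a b c d) = δ * (R * R) + 4 * (a * d) ≡ (a + d) * (a + d) + 4 * (b * c)

  -- The discriminant is the squared trace minus 4, that is 4 ((p² + δ e²)² - 1). As p² - δ e² = 1,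
  -- this equals 16 p² δ e² = δ (4 p e)².
  norm1⇒disc : ∀ {δ p e} M → let open Mat M in p * p ≡ 1 + δ * e * e →
    a₁₁ + a₂₂ ≡ 2 * (p * p + δ * e * e) → Det₊ M → Disc δ (4 * (p * e)) M
  norm1⇒disc {δ} {p} {e} (mat a b c d) norm1 tr det = begin
    δ * (4 * (p * e) * (4 * (p * e))) + 4 * (a * d)              ≡⟨ cong₂ (λ x y → x + 4 * y) (l₁ δ p e) det ⟩
    16 * (p * p * (δ * e * e)) + 4 * (1 + b * c)                 ≡⟨ cong (λ x → 16 * (x * (δ * e * e)) + 4 * (1 + b * c)) norm1 ⟩
    16 * ((1 + δ * e * e) * (δ * e * e)) + 4 * (1 + b * c)       ≡⟨ l₂ (δ * e * e) (b * c) ⟩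
    square (2 * (1 + δ * e * e + δ * e * e)) + 4 * (b * c)       ≡⟨ cong (λ x → square (2 * (x + δ * e * e)) + 4 * (b * c)) norm1 ⟨
    square (2 * (p * p + δ * e * e)) + 4 * (b * c)               ≡⟨ cong (λ x → square x + 4 * (b * c)) tr ⟨
    (a + d) * (a + d) + 4 * (b * c)                              ∎
    where
    open ≡-Reasoning
    square : ℕ → ℕ
    square x = x * x
    l₁ : ∀ δ p e → δ * (4 * (p * e) * (4 * (p * e))) ≡ 16 * (p * p * (δ * e * e))
    l₁ = solve-∀
    l₂ : ∀ y b → 16 * ((1 + y) * y) + 4 * (1 + b) ≡ 2 * (1 + y + y) * (2 * (1 + y + y)) + 4 * b
    l₂ = solve-∀

  -- The word t is split as z + 1, c, r because Y lowers its first digit to z, and if z = 0 the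
  -- second digit c is needed to absorb it.
  record Approx (δ s : ℕ) : Set where
    field
      z c : ℕ
      r   : List ℕ
      isUnit : IsUnit δ s (suc z ∷ c ∷ r)
      norm1  : Norm1 isUnit

    open IsUnit isUnit public

  module _ {δ s′ : ℕ} (α : Approx δ (suc s′)) where
    open Approx α
    private
      s = suc s′

    -- With its leading 1, this is 1, 1, z, c, r, s, 1, 1, s - 1, z + 1, c, r after zeros are
    -- absorbed; each `join` supplies the second 1 of a pair.
    period′ : List ℕ
    period′ = join z c (r ++ s ∷ 1 ∷ join s′ (suc z) (c ∷ r))

    -- The largest digits come from absorbing a 0, which adds 1 to a digit of t and so stays within
    -- 2 s + 1.
    period-digits : All (Digit (4 * s + 1)) (1 ∷ period′)
    period-digits with All.map (λ (1≤c , c≤2s) → 1≤c , ≤-trans c≤2s 2s≤) digits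
      where
      2s≤ : 2 * s ≤ 4 * s + 1
      2s≤ = ≤-trans (*-monoˡ-≤ s (s≤s (s≤s (z≤n {2})))) (m≤m+n (4 * s) 1)
    ... | d₁@(1≤z , z<) ∷ d₂ ∷ ds = (≤-refl , 1≤) ∷ join-digits 1≤ (≤-trans (n≤1+n z) z<) (1+digit (All.head (All.tail digits)))
      (d₂ ∷ ++⁺ ds ((s≤s z≤n , s≤) ∷ (≤-refl , 1≤) ∷ join-digits 1≤ (≤-trans (n≤1+n s′) s≤) (1+digit (All.head digits)) (d₁ ∷ d₂ ∷ ds)))
      where
      1≤ : 1 ≤ 4 * s + 1
      1≤ = m≤n+m 1 (4 * s)
      s≤ : s ≤ 4 * s + 1
      s≤ = ≤-trans (m≤n*m s 4) (m≤m+n (4 * s) 1)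
      1+digit : ∀ {x} → Digit (2 * s) x → suc x ≤ 4 * s + 1
      1+digit {x} (_ , x≤2s) = begin
        suc x       ≤⟨ s≤s x≤2s ⟩
        1 + 2 * s   ≡⟨ +-comm 1 (2 * s) ⟩
        2 * s + 1   ≤⟨ +-monoˡ-≤ 1 (*-monoˡ-≤ s (s≤s (s≤s (z≤n {2})))) ⟩
        4 * s + 1   ∎
        where open ≤-Reasoning

    period-word : word (1 ∷ period′) ≡ quot 1 (quot 1 (quot z (word (c ∷ r)))) ⊗ twist s′ (word (suc z ∷ c ∷ r))
    period-word = begin
      quot 1 (word period′)
        ≡⟨ cong (quot 1) (word-join z c _) ⟩
      word (1 ∷ 1 ∷ z ∷ c ∷ r ++ s ∷ 1 ∷ join s′ (suc z) (c ∷ r))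
        ≡⟨ word-++ (1 ∷ 1 ∷ z ∷ c ∷ r) _ ⟩
      word (1 ∷ 1 ∷ z ∷ c ∷ r) ⊗ word (s ∷ 1 ∷ join s′ (suc z) (c ∷ r))
        ≡⟨ cong (λ M → word (1 ∷ 1 ∷ z ∷ c ∷ r) ⊗ quot s (quot 1 M)) (word-join s′ (suc z) (c ∷ r)) ⟩
      word (1 ∷ 1 ∷ z ∷ c ∷ r) ⊗ word (s ∷ 1 ∷ 1 ∷ s′ ∷ suc z ∷ c ∷ r) ∎
      where open ≡-Reasoning

    private
      P = word (1 ∷ period′)
      open Mat (word (c ∷ r)) renaming (a₁₁ to b₁₁; a₁₂ to b₁₂; a₂₁ to b₂₁; a₂₂ to b₂₂)
      u = z * b₁₁ + b₂₁
      w = z * b₁₂ + b₂₂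

      -- The lower row of `word (suc z ∷ c ∷ r)` is the upper row of `word (c ∷ r)`.
      tail≡ : (b₁₁ ≡ f × b₁₂ ≡ h)
      tail≡ = proj₂ (mat-injective word≡)

      e≡ : e ≡ u + f
      e≡ = begin
        e                      ≡⟨ proj₁ (proj₁ (mat-injective word≡)) ⟨
        suc z * b₁₁ + b₂₁      ≡⟨ l z b₁₁ b₂₁ ⟩
        u + b₁₁                ≡⟨ cong (u +_) (proj₁ tail≡) ⟩
        u + f                  ∎
        where
        open ≡-Reasoning
        l : ∀ z x y → suc z * x + y ≡ z * x + y + x
        l = solve-∀

      f≡ : f ≡ w + h
      f≡ = begin
        f                      ≡⟨ proj₂ (proj₁ (mat-injective word≡)) ⟨
        suc z * b₁₂ + b₂₂      ≡⟨ l z b₁₂ b₂₂ ⟩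
        w + b₁₂                ≡⟨ cong (w +_) (proj₂ tail≡) ⟩
        w + h                  ∎
        where
        open ≡-Reasoning
        l : ∀ z x y → suc z * x + y ≡ z * x + y + x
        l = solve-∀

      P≡ : P ≡ quot 1 (quot 1 (mat u w f h)) ⊗ twist s′ (mat e f f h)
      P≡ = begin
        P
          ≡⟨ period-word ⟩
        quot 1 (quot 1 (mat u w b₁₁ b₁₂)) ⊗ twist s′ (word (suc z ∷ c ∷ r))
          ≡⟨ cong₂ (λ x y → quot 1 (quot 1 (mat u w x y)) ⊗ twist s′ (word (suc z ∷ c ∷ r))) (proj₁ tail≡) (proj₂ tail≡) ⟩
        quot 1 (quot 1 (mat u w f h)) ⊗ twist s′ (word (suc z ∷ c ∷ r))
          ≡⟨ cong (λ N → quot 1 (quot 1 (mat u w f h)) ⊗ twist s′ N) word≡ ⟩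
        quot 1 (quot 1 (mat u w f h)) ⊗ twist s′ (mat e f f h) ∎
        where open ≡-Reasoning

      -- Stated for variable e, f and M, so that the equations can be substituted and the results on
      -- `V`, where e and f are sums, apply directly.
      facts : ∀ {e f M} → e ≡ u + f → f ≡ w + h → f * f ≡ 1 + e * h →
        M ≡ quot 1 (quot 1 (mat u w f h)) ⊗ twist s′ (mat e f f h) →
        Mat.a₂₁ M ≡ 2 * ((f + s * e) * (f + s * e)) ×
        Mat.a₁₁ M + Mat.a₂₂ M ≡ 2 * ((f + s * e) * (f + s * e) + (h + 2 * s * f + s * s * e) * e) ×
        Det₊ M
      facts refl refl ff≡1+eh refl = twisted-corner s′ u w h , twisted-trace s′ u w h , twisted-det s′ u w h ff≡1+eh

    period-corner : Mat.a₂₁ P ≡ 2 * (p * p)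
    period-corner = proj₁ (facts e≡ f≡ (norm1⇒det₋ z<s isUnit norm1) P≡)

    period-disc : Disc δ (4 * (p * e)) P
    period-disc = norm1⇒disc {δ} {p} {e} P norm1 (trans (proj₁ (proj₂ facts′)) (cong (λ x → 2 * (p * p + x * e)) norm)) (proj₂ (proj₂ facts′))
      where facts′ = facts e≡ f≡ (norm1⇒det₋ z<s isUnit norm1) P≡

open Units

-- Fixed points in ℚ(√δ)

module Roots where

  open import Algebra.Properties.Group using (∙-cancelʳ)
  open import Data.Integer.Base as ℤ using (+_)
  import Data.Integer.Properties as ℤ
  open import Data.Nat.Base as ℕ using (ℕ; zero; suc; z<s)
  import Data.Nat.Properties as ℕ
  open import Data.Nat.Tactic.RingSolver using (solve-∀)
  open import Data.Rational.Base
  open import Data.Rational.Properties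
  open import Data.Rational.Solver using (module +-*-Solver)
  import Data.Rational.Unnormalised.Base as ℚᵘ
  import Data.Rational.Unnormalised.Properties as ℚᵘ
  open import Defs using (_+_√; re; signed; fromℕ; fromℚ)
  open +-*-Solver using (solve; _:=_; _:+_; _:*_; _:-_; :-_; con)

  κ : ℕ → ℚ
  κ n = + n / 1

  κᵘ : ∀ n → toℚᵘ (κ n) ℚᵘ.≃ ℚᵘ.mkℚᵘ (+ n) 0
  κᵘ n = toℚᵘ-fromℚᵘ (ℚᵘ.mkℚᵘ (+ n) 0)

  κ-+ : ∀ m n → κ (m ℕ.+ n) ≡ κ m + κ n
  κ-+ m n = toℚᵘ-injective (begin
    toℚᵘ (κ (m ℕ.+ n))                           ≈⟨ κᵘ (m ℕ.+ n) ⟩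
    ℚᵘ.mkℚᵘ (+ (m ℕ.+ n)) 0                      ≈⟨ ℚᵘ.*≡* (cong (ℤ._* + 1) (sym (cong₂ ℤ._+_ (ℤ.*-identityʳ (+ m)) (ℤ.*-identityʳ (+ n))))) ⟩
    ℚᵘ.mkℚᵘ (+ m) 0 ℚᵘ.+ ℚᵘ.mkℚᵘ (+ n) 0         ≈⟨ ℚᵘ.+-cong (κᵘ m) (κᵘ n) ⟨
    toℚᵘ (κ m) ℚᵘ.+ toℚᵘ (κ n)                   ≈⟨ toℚᵘ-homo-+ (κ m) (κ n) ⟨
    toℚᵘ (κ m + κ n)                             ∎)
    where open import Relation.Binary.Reasoning.Setoid ℚᵘ.≃-setoid

  κ-* : ∀ m n → κ (m ℕ.* n) ≡ κ m * κ n
  κ-* m n = toℚᵘ-injective (begin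
    toℚᵘ (κ (m ℕ.* n))                           ≈⟨ κᵘ (m ℕ.* n) ⟩
    ℚᵘ.mkℚᵘ (+ (m ℕ.* n)) 0                      ≈⟨ ℚᵘ.*≡* (cong (ℤ._* + 1) (ℤ.pos-* m n)) ⟩
    ℚᵘ.mkℚᵘ (+ m) 0 ℚᵘ.* ℚᵘ.mkℚᵘ (+ n) 0         ≈⟨ ℚᵘ.*-cong (κᵘ m) (κᵘ n) ⟨
    toℚᵘ (κ m) ℚᵘ.* toℚᵘ (κ n)                   ≈⟨ toℚᵘ-homo-* (κ m) (κ n) ⟨
    toℚᵘ (κ m * κ n)                             ∎)
    where open import Relation.Binary.Reasoning.Setoid ℚᵘ.≃-setoid

  0≤κ : ∀ n → 0ℚ ≤ κ n
  0≤κ n = nonNegative⁻¹ (κ n) {{normalize-nonNeg n 1}}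

  0<κ : ∀ {n} → 0 ℕ.< n → 0ℚ < κ n
  0<κ {suc n} _ = positive⁻¹ (κ (suc n)) {{normalize-pos (suc n) 1}}

  -- Junk value: recip 0 = 0.
  recip : ℕ → ℚ
  recip zero    = 0ℚ
  recip (suc n) = + 1 / suc n

  0≤recip : ∀ n → 0ℚ ≤ recip n
  0≤recip zero    = ≤-refl
  0≤recip (suc n) = nonNegative⁻¹ (recip (suc n)) {{normalize-nonNeg 1 (suc n)}}

  0<recip : ∀ {n} → 0 ℕ.< n → 0ℚ < recip n
  0<recip {suc n} _ = positive⁻¹ (recip (suc n)) {{normalize-pos 1 (suc n)}}

  κ*recip : ∀ {n} → 0 ℕ.< n → κ n * recip n ≡ 1ℚ
  κ*recip {suc n} _ = toℚᵘ-injective (begin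
    toℚᵘ (κ (suc n) * recip (suc n))                  ≈⟨ toℚᵘ-homo-* (κ (suc n)) (recip (suc n)) ⟩
    toℚᵘ (κ (suc n)) ℚᵘ.* toℚᵘ (recip (suc n))        ≈⟨ ℚᵘ.*-cong (κᵘ (suc n)) (toℚᵘ-fromℚᵘ (ℚᵘ.mkℚᵘ (+ 1) n)) ⟩
    ℚᵘ.mkℚᵘ (+ suc n) 0 ℚᵘ.* ℚᵘ.mkℚᵘ (+ 1) n          ≈⟨ ℚᵘ.*≡* (cong (λ x → + suc x) (l n)) ⟩
    toℚᵘ 1ℚ                                           ∎)
    where
    open import Relation.Binary.Reasoning.Setoid ℚᵘ.≃-setoid
    l : ∀ n → (n ℕ.* 1) ℕ.* 1 ≡ n ℕ.+ 0 ℕ.+ 0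
    l = solve-∀

  0≤p*q : ∀ {p q} → 0ℚ ≤ p → 0ℚ ≤ q → 0ℚ ≤ p * q
  0≤p*q {p} {q} 0≤p 0≤q = nonNegative⁻¹ (p * q) {{nonNeg*nonNeg⇒nonNeg p {{nonNegative 0≤p}} q {{nonNegative 0≤q}}}}

  0<p*q : ∀ {p q} → 0ℚ < p → 0ℚ < q → 0ℚ < p * q
  0<p*q {p} {q} 0<p 0<q = positive⁻¹ (p * q) {{pos*pos⇒pos p {{positive 0<p}} q {{positive 0<q}}}}

  module _ {δ : ℕ} where

    -- Here q √δ is at least ∣p∣. For ∣p∣ = -p the squares of p cancel in `signed` and the slack x
    -- remains; otherwise all its terms are nonnegative.
    signed-nonNeg : ∀ (p q : ℚ) {x} → 0ℚ ≤ q → 0ℚ ≤ x → κ δ * (q * q) ≡ p * p + x → 0ℚ ≤ signed {δ} (p + q √)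
    signed-nonNeg p q {x} 0≤q 0≤x eq rewrite 0≤p⇒∣p∣≡p 0≤q | eq with ∣p∣≡p∨∣p∣≡-p p
    ... | inj₁ ∣p∣≡p rewrite ∣p∣≡p = +-mono-≤ 0≤p² (+-mono-≤ 0≤p² 0≤x)
      where
      0≤p² : 0ℚ ≤ p * p
      0≤p² = 0≤p*q (∣p∣≡p⇒0≤p ∣p∣≡p) (∣p∣≡p⇒0≤p ∣p∣≡p)
    ... | inj₂ ∣p∣≡-p rewrite ∣p∣≡-p = subst (0ℚ ≤_) (l p x) 0≤x
      where
      l : ∀ p x → x ≡ p * - p + (p * p + x)
      l = solve 2 (λ p x → x := p :* :- p :+ (p :* p :+ x)) refl

    -- Under these signs `signed` is p² - δ q², which is the slack x.
    signed-pos : ∀ (p q : ℚ) {x} → 0ℚ ≤ p → 0ℚ ≤ q → 0ℚ < x → p * p ≡ κ δ * (q * q) + x → 0ℚ < signed {δ} (p + (0ℚ - q) √)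
    signed-pos p q {x} 0≤p 0≤q 0<x eq rewrite +-identityˡ (- q) | ∣-p∣≡∣p∣ q | 0≤p⇒∣p∣≡p 0≤q | 0≤p⇒∣p∣≡p 0≤p | eq =
      subst (0ℚ <_) (l (κ δ) q x) 0<x
      where
      l : ∀ d q x → x ≡ d * (q * q) + x + d * (- q * q)
      l = solve 3 (λ d q x → x := d :* (q :* q) :+ x :+ d :* (:- q :* q)) refl

  -- The larger fixed point (a - d + R √δ) / 2c of the matrix [[a,b],[c,d]].
  root : ∀ {δ} → ℕ → Mat → ℚ[√ δ ]
  root R (mat a b c d) = ((κ a - κ d) * recip (2 ℕ.* c)) + (κ R * recip (2 ℕ.* c)) √

  -- With Q = [[x,1],[1,0]] this is M Q, the conjugate of Q M by Q: the first digit x of a period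
  -- moves to its end.
  rotate : ℕ → Mat → Mat
  rotate x (mat a b c d) = mat (x ℕ.* a ℕ.+ b) a (x ℕ.* c ℕ.+ d) c

  ⊗-quot-I : ∀ x M → M ⊗ quot x I ≡ rotate x M
  ⊗-quot-I x (mat a b c d) = mat-cong (l₁ x a b) (l₂ x a b) (l₁ x c d) (l₂ x c d)
    where
    l₁ : ∀ x a b → a ℕ.* (x ℕ.* 1 ℕ.+ 0) ℕ.+ b ℕ.* 1 ≡ x ℕ.* a ℕ.+ b
    l₁ = solve-∀
    l₂ : ∀ x a b → a ℕ.* (x ℕ.* 0 ℕ.+ 1) ℕ.+ b ℕ.* 0 ≡ a
    l₂ = solve-∀

  -- For `quot x M` = [[a,b],[c,d]] it says that c ξ² + (d - a) ξ - b is negative at ξ = 1, so the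
  -- larger fixed point exceeds 1. This is what `floor-<` needs of the next complete quotient.
  quot-rows : ∀ {x M} → 0 ℕ.< x → Admissible M →
    let open Mat (quot x M) in a₂₁ ℕ.+ a₂₂ ℕ.< a₁₁ ℕ.+ a₁₂
  quot-rows {suc x} {mat a b c d} _ (admissible _ 0<c+d) = begin-strict
    a ℕ.+ b                                              <⟨ ℕ.m<m+n (a ℕ.+ b) 0<c+d ⟩
    a ℕ.+ b ℕ.+ (c ℕ.+ d)                                ≤⟨ ℕ.m≤n+m _ (x ℕ.* (a ℕ.+ b)) ⟩
    x ℕ.* (a ℕ.+ b) ℕ.+ (a ℕ.+ b ℕ.+ (c ℕ.+ d))          ≡⟨ l x a b c d ⟩
    suc x ℕ.* a ℕ.+ c ℕ.+ (suc x ℕ.* b ℕ.+ d)            ∎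
    where
    open ℕ.≤-Reasoning
    l : ∀ x a b c d → x ℕ.* (a ℕ.+ b) ℕ.+ (a ℕ.+ b ℕ.+ (c ℕ.+ d)) ≡ suc x ℕ.* a ℕ.+ c ℕ.+ (suc x ℕ.* b ℕ.+ d)
    l = solve-∀

  module _ {δ R : ℕ} (x : ℕ) (N : Mat) (disc : Disc δ R (quot x N)) where
    open Mat N renaming (a₁₁ to a; a₁₂ to b; a₂₁ to c; a₂₂ to d)

    private
      -- Cancelling the terms in x a b leaves b and c in symmetric roles, except for names;
      -- exchanging them turns the equation for Q N into the one for N Q.
      disc′ : δ ℕ.* (R ℕ.* R) ℕ.+ 4 ℕ.* (b ℕ.* c) ≡ (x ℕ.* a ℕ.+ b ℕ.+ c) ℕ.* (x ℕ.* a ℕ.+ b ℕ.+ c) ℕ.+ 4 ℕ.* (a ℕ.* d)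
      disc′ = ℕ.+-cancelʳ-≡ (4 ℕ.* (x ℕ.* a ℕ.* b)) _ _ (begin
        δ ℕ.* (R ℕ.* R) ℕ.+ 4 ℕ.* (b ℕ.* c) ℕ.+ 4 ℕ.* (x ℕ.* a ℕ.* b) ≡⟨ l₁ (δ ℕ.* (R ℕ.* R)) x a b c ⟩
        δ ℕ.* (R ℕ.* R) ℕ.+ 4 ℕ.* ((x ℕ.* a ℕ.+ c) ℕ.* b)             ≡⟨ disc ⟩
        _                                                             ≡⟨ l₂ x a b c d ⟩
        _                                                             ∎)
        where
        open ≡-Reasoning
        l₁ : ∀ D x a b c → D ℕ.+ 4 ℕ.* (b ℕ.* c) ℕ.+ 4 ℕ.* (x ℕ.* a ℕ.* b) ≡ D ℕ.+ 4 ℕ.* ((x ℕ.* a ℕ.+ c) ℕ.* b)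
        l₁ = solve-∀
        l₂ : ∀ x a b c d → (x ℕ.* a ℕ.+ c ℕ.+ b) ℕ.* (x ℕ.* a ℕ.+ c ℕ.+ b) ℕ.+ 4 ℕ.* ((x ℕ.* b ℕ.+ d) ℕ.* a)
          ≡ (x ℕ.* a ℕ.+ b ℕ.+ c) ℕ.* (x ℕ.* a ℕ.+ b ℕ.+ c) ℕ.+ 4 ℕ.* (a ℕ.* d) ℕ.+ 4 ℕ.* (x ℕ.* a ℕ.* b)
        l₂ = solve-∀

    rotate-disc : Disc δ R (rotate x N)
    rotate-disc = begin
      δ ℕ.* (R ℕ.* R) ℕ.+ 4 ℕ.* ((x ℕ.* a ℕ.+ b) ℕ.* c)               ≡⟨ l₁ (δ ℕ.* (R ℕ.* R)) x a b c ⟩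
      δ ℕ.* (R ℕ.* R) ℕ.+ 4 ℕ.* (b ℕ.* c) ℕ.+ 4 ℕ.* (x ℕ.* a ℕ.* c)   ≡⟨ cong (ℕ._+ 4 ℕ.* (x ℕ.* a ℕ.* c)) disc′ ⟩
      _                                                               ≡⟨ l₂ x a b c d ⟩
      _                                                               ∎
      where
      open ≡-Reasoning
      l₁ : ∀ D x a b c → D ℕ.+ 4 ℕ.* ((x ℕ.* a ℕ.+ b) ℕ.* c) ≡ D ℕ.+ 4 ℕ.* (b ℕ.* c) ℕ.+ 4 ℕ.* (x ℕ.* a ℕ.* c)
      l₁ = solve-∀
      l₂ : ∀ x a b c d → (x ℕ.* a ℕ.+ b ℕ.+ c) ℕ.* (x ℕ.* a ℕ.+ b ℕ.+ c) ℕ.+ 4 ℕ.* (a ℕ.* d) ℕ.+ 4 ℕ.* (x ℕ.* a ℕ.* c)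
        ≡ (x ℕ.* a ℕ.+ b ℕ.+ c) ℕ.* (x ℕ.* a ℕ.+ b ℕ.+ c) ℕ.+ 4 ℕ.* (a ℕ.* (x ℕ.* c ℕ.+ d))
      l₂ = solve-∀

    private
      -- Now `rotate x N` is [[t,a],[y,c]]. Its root is (U + R √δ) / 2y, while the root of
      -- `quot x N` minus x is (-U + R √δ) / 2a.
      t y : ℕ
      t = x ℕ.* a ℕ.+ b
      y = x ℕ.* c ℕ.+ d

      U j j′ : ℚ
      U  = κ t - κ c
      j  = recip (2 ℕ.* a)
      j′ = recip (2 ℕ.* y)

      δR² : κ δ * (κ R * κ R) ≡ U * U + κ (4 ℕ.* (a ℕ.* y))
      δR² = ∙-cancelʳ +-0-group (κ 4 * (κ t * κ c)) _ _ (begin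
        κ δ * (κ R * κ R) + κ 4 * (κ t * κ c)                           ≡⟨ cong₂ (λ u v → κ δ * u + κ 4 * v) (κ-* R R) (κ-* t c) ⟨
        κ δ * κ (R ℕ.* R) + κ 4 * κ (t ℕ.* c)                           ≡⟨ cong₂ _+_ (κ-* δ (R ℕ.* R)) (κ-* 4 (t ℕ.* c)) ⟨
        κ (δ ℕ.* (R ℕ.* R)) + κ (4 ℕ.* (t ℕ.* c))                       ≡⟨ κ-+ (δ ℕ.* (R ℕ.* R)) (4 ℕ.* (t ℕ.* c)) ⟨
        κ (δ ℕ.* (R ℕ.* R) ℕ.+ 4 ℕ.* (t ℕ.* c))                         ≡⟨ cong κ rotate-disc ⟩
        κ ((t ℕ.+ c) ℕ.* (t ℕ.+ c) ℕ.+ 4 ℕ.* (a ℕ.* y))                 ≡⟨ κ-+ ((t ℕ.+ c) ℕ.* (t ℕ.+ c)) (4 ℕ.* (a ℕ.* y)) ⟩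
        κ ((t ℕ.+ c) ℕ.* (t ℕ.+ c)) + κ (4 ℕ.* (a ℕ.* y))               ≡⟨ cong (_+ κ (4 ℕ.* (a ℕ.* y))) (κ-* (t ℕ.+ c) (t ℕ.+ c)) ⟩
        κ (t ℕ.+ c) * κ (t ℕ.+ c) + κ (4 ℕ.* (a ℕ.* y))                 ≡⟨ cong (λ z → z * z + κ (4 ℕ.* (a ℕ.* y))) (κ-+ t c) ⟩
        (κ t + κ c) * (κ t + κ c) + κ (4 ℕ.* (a ℕ.* y))                 ≡⟨ l (κ t) (κ c) (κ (4 ℕ.* (a ℕ.* y))) ⟩
        U * U + κ (4 ℕ.* (a ℕ.* y)) + κ 4 * (κ t * κ c)                 ∎)
        where
        open ≡-Reasoning
        l : ∀ t c w → (t + c) * (t + c) + w ≡ (t - c) * (t - c) + w + κ 4 * (t * c)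
        l = solve 3 (λ t c w → (t :+ c) :* (t :+ c) :+ w := (t :- c) :* (t :- c) :+ w :+ con (κ 4) :* (t :* c)) refl

      κ2* : ∀ n → κ (2 ℕ.* n) ≡ κ n + κ n
      κ2* n = trans (cong (λ z → κ (n ℕ.+ z)) (ℕ.+-identityʳ n)) (κ-+ n n)

    module _ (0<a : 0 ℕ.< a) where
      private
        2aj≡1 : κ (2 ℕ.* a) * j ≡ 1ℚ
        2aj≡1 = κ*recip (ℕ.<-≤-trans 0<a (ℕ.m≤m+n a (a ℕ.+ 0)))

        x₀ = re {δ} (root R (quot x N))

        x₀-x : x₀ - κ x ≡ - (U * j)
        x₀-x = begin
          (κ (x ℕ.* a ℕ.+ c) - κ b) * j - κ x
            ≡⟨ cong (λ z → (κ (x ℕ.* a ℕ.+ c) - κ b) * j - z) (trans (sym (*-identityʳ (κ x))) (cong (κ x *_) (sym (trans (cong (_* j) (sym (κ2* a))) 2aj≡1)))) ⟩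
          (κ (x ℕ.* a ℕ.+ c) - κ b) * j - κ x * ((κ a + κ a) * j)
            ≡⟨ cong (λ z → (z - κ b) * j - κ x * ((κ a + κ a) * j)) (κ-xa+ c) ⟩
          (κ x * κ a + κ c - κ b) * j - κ x * ((κ a + κ a) * j)
            ≡⟨ l (κ x) (κ a) (κ b) (κ c) j ⟩
          - ((κ x * κ a + κ b - κ c) * j)
            ≡⟨ cong (λ z → - ((z - κ c) * j)) (κ-xa+ b) ⟨
          - (U * j) ∎
          where
          open ≡-Reasoning
          κ-xa+ : ∀ n → κ (x ℕ.* a ℕ.+ n) ≡ κ x * κ a + κ n
          κ-xa+ n = trans (κ-+ (x ℕ.* a) n) (cong (_+ κ n) (κ-* x a))
          l : ∀ x a b c j → (x * a + c - b) * j - x * ((a + a) * j) ≡ - ((x * a + b - c) * j)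
          l = solve 5 (λ x a b c j → (x :* a :+ c :- b) :* j :- x :* ((a :+ a) :* j) := :- ((x :* a :+ b :- c) :* j)) refl

      -- The product (-U + R √δ)(U + R √δ) = δ R² - U² is 4 a y, which the denominators 2 a and 2 y
      -- cancel.
      root-step : 0 ℕ.< y → (root R (quot x N) Defs.- fromℕ x) Defs.* root R (rotate x N) ≡ fromℚ {δ} 1ℚ
      root-step 0<y = cong₂ _+_√ real imag
        where
        open ≡-Reasoning
        real : (x₀ - κ x) * (U * j′) + κ δ * ((κ R * j - 0ℚ) * (κ R * j′)) ≡ 1ℚ
        real = begin
          (x₀ - κ x) * (U * j′) + κ δ * ((κ R * j - 0ℚ) * (κ R * j′))
            ≡⟨ cong (λ z → z * (U * j′) + κ δ * ((κ R * j - 0ℚ) * (κ R * j′))) x₀-x ⟩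
          - (U * j) * (U * j′) + κ δ * ((κ R * j - 0ℚ) * (κ R * j′))
            ≡⟨ l₁ U j j′ (κ δ) (κ R) ⟩
          (κ δ * (κ R * κ R) - U * U) * (j * j′)
            ≡⟨ cong (λ z → (z - U * U) * (j * j′)) δR² ⟩
          (U * U + κ (4 ℕ.* (a ℕ.* y)) - U * U) * (j * j′)
            ≡⟨ cong (λ z → (U * U + z - U * U) * (j * j′)) (trans (cong κ (l₂ a y)) (κ-* (2 ℕ.* a) (2 ℕ.* y))) ⟩
          (U * U + κ (2 ℕ.* a) * κ (2 ℕ.* y) - U * U) * (j * j′)
            ≡⟨ l₃ U (κ (2 ℕ.* a)) (κ (2 ℕ.* y)) j j′ ⟩
          (κ (2 ℕ.* a) * j) * (κ (2 ℕ.* y) * j′)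
            ≡⟨ cong₂ _*_ 2aj≡1 (κ*recip (ℕ.<-≤-trans 0<y (ℕ.m≤m+n y (y ℕ.+ 0)))) ⟩
          1ℚ ∎
          where
          l₁ : ∀ u j k d r → - (u * j) * (u * k) + d * ((r * j - 0ℚ) * (r * k)) ≡ (d * (r * r) - u * u) * (j * k)
          l₁ = solve 5 (λ u j k d r → :- (u :* j) :* (u :* k) :+ d :* ((r :* j :- con 0ℚ) :* (r :* k))
            := (d :* (r :* r) :- u :* u) :* (j :* k)) refl
          l₂ : ∀ a y → 4 ℕ.* (a ℕ.* y) ≡ 2 ℕ.* a ℕ.* (2 ℕ.* y)
          l₂ = solve-∀
          l₃ : ∀ u m n j k → (u * u + m * n - u * u) * (j * k) ≡ (m * j) * (n * k)
          l₃ = solve 5 (λ u m n j k → (u :* u :+ m :* n :- u :* u) :* (j :* k) := (m :* j) :* (n :* k)) refl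
        imag : (x₀ - κ x) * (κ R * j′) + (κ R * j - 0ℚ) * (U * j′) ≡ 0ℚ
        imag = trans (cong (λ z → z * (κ R * j′) + (κ R * j - 0ℚ) * (U * j′)) x₀-x) (l U j j′ (κ R))
          where
          l : ∀ u j k r → - (u * j) * (r * k) + (r * j - 0ℚ) * (u * k) ≡ 0ℚ
          l = solve 4 (λ u j k r → :- (u :* j) :* (r :* k) :+ (r :* j :- con 0ℚ) :* (u :* k) := con 0ℚ) refl

      -- It suffices that R √δ ≥ U, and δ R² exceeds U² by 4 a y ≥ 0.
      floor-≤ : fromℕ x Defs.≤ root {δ} R (quot x N)
      floor-≤ = signed-nonNeg {δ} (x₀ - κ x) (κ R * j - 0ℚ) {κ (4 ℕ.* (a ℕ.* y)) * (j * j)}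
        (subst (0ℚ ≤_) (sym (+-identityʳ (κ R * j))) (0≤p*q (0≤κ R) (0≤recip (2 ℕ.* a))))
        (0≤p*q (0≤κ (4 ℕ.* (a ℕ.* y))) (0≤p*q (0≤recip (2 ℕ.* a)) (0≤recip (2 ℕ.* a))))
        (begin
          κ δ * ((κ R * j - 0ℚ) * (κ R * j - 0ℚ))           ≡⟨ l₁ (κ δ) (κ R) j ⟩
          κ δ * (κ R * κ R) * (j * j)                       ≡⟨ cong (_* (j * j)) δR² ⟩
          (U * U + κ (4 ℕ.* (a ℕ.* y))) * (j * j)           ≡⟨ l₂ U (κ (4 ℕ.* (a ℕ.* y))) j ⟩
          - (U * j) * - (U * j) + κ (4 ℕ.* (a ℕ.* y)) * (j * j) ≡⟨ cong (λ z → z * z + κ (4 ℕ.* (a ℕ.* y)) * (j * j)) x₀-x ⟨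
          (x₀ - κ x) * (x₀ - κ x) + κ (4 ℕ.* (a ℕ.* y)) * (j * j) ∎)
        where
        open ≡-Reasoning
        l₁ : ∀ d r j → d * ((r * j - 0ℚ) * (r * j - 0ℚ)) ≡ d * (r * r) * (j * j)
        l₁ = solve 3 (λ d r j → d :* ((r :* j :- con 0ℚ) :* (r :* j :- con 0ℚ)) := d :* (r :* r) :* (j :* j)) refl
        l₂ : ∀ u w j → (u * u + w) * (j * j) ≡ - (u * j) * - (u * j) + w * (j * j)
        l₂ = solve 3 (λ u w j → (u :* u :+ w) :* (j :* j) := :- (u :* j) :* :- (u :* j) :+ w :* (j :* j)) refl

      -- Let v > 0 be the difference of the row sums. Then U = y + v - a, so 2 a + U = y + v + a,
      -- whose square exceeds δ R² = U² + 4 a y by 4 a v.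
      floor-< : y ℕ.+ c ℕ.< t ℕ.+ a → root {δ} R (quot x N) Defs.< fromℕ (suc x)
      floor-< y+c<t+a = signed-pos {δ} (κ (suc x) - x₀) (κ R * j) {κ (4 ℕ.* (a ℕ.* v)) * (j * j)}
        (subst (0ℚ ≤_) (sym 1+x-x₀) (0≤p*q (0≤κ (y ℕ.+ v ℕ.+ a)) (0≤recip (2 ℕ.* a))))
        (0≤p*q (0≤κ R) (0≤recip (2 ℕ.* a)))
        (0<p*q (0<κ (ℕ.*-mono-< (z<s {3}) (ℕ.*-mono-< 0<a (ℕ.m<n⇒0<n∸m y+c<t+a)))) (0<p*q 0<j 0<j))
        (begin
          (κ (suc x) - x₀) * (κ (suc x) - x₀)                           ≡⟨ cong (λ z → z * z) (trans 1+x-x₀ (cong (_* j) κ-yva)) ⟩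
          (κ y + κ v + κ a) * j * ((κ y + κ v + κ a) * j)               ≡⟨ l (κ y) (κ v) (κ a) j ⟩
          ((κ y + κ v - κ a) * (κ y + κ v - κ a) + κ 4 * (κ a * κ y)) * (j * j) + κ 4 * (κ a * κ v) * (j * j)
            ≡⟨ cong₂ (λ m n → ((κ y + κ v - κ a) * (κ y + κ v - κ a) + m) * (j * j) + n * (j * j)) (4ab a y) (4ab a v) ⟨
          ((κ y + κ v - κ a) * (κ y + κ v - κ a) + κ (4 ℕ.* (a ℕ.* y))) * (j * j) + κ (4 ℕ.* (a ℕ.* v)) * (j * j)
            ≡⟨ cong (λ z → (z * z + κ (4 ℕ.* (a ℕ.* y))) * (j * j) + κ (4 ℕ.* (a ℕ.* v)) * (j * j)) U≡ ⟨
          (U * U + κ (4 ℕ.* (a ℕ.* y))) * (j * j) + κ (4 ℕ.* (a ℕ.* v)) * (j * j)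
            ≡⟨ cong (λ z → z * (j * j) + κ (4 ℕ.* (a ℕ.* v)) * (j * j)) δR² ⟨
          κ δ * (κ R * κ R) * (j * j) + κ (4 ℕ.* (a ℕ.* v)) * (j * j)   ≡⟨ l₂ (κ δ) (κ R) j _ ⟩
          κ δ * (κ R * j * (κ R * j)) + κ (4 ℕ.* (a ℕ.* v)) * (j * j)   ∎)
        where
        open ≡-Reasoning
        v = (t ℕ.+ a) ℕ.∸ (y ℕ.+ c)

        0<j : 0ℚ < j
        0<j = 0<recip (ℕ.<-≤-trans 0<a (ℕ.m≤m+n a (a ℕ.+ 0)))

        4ab : ∀ m n → κ (4 ℕ.* (m ℕ.* n)) ≡ κ 4 * (κ m * κ n)
        4ab m n = trans (κ-* 4 (m ℕ.* n)) (cong (κ 4 *_) (κ-* m n))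

        κ-yva : κ (y ℕ.+ v ℕ.+ a) ≡ κ y + κ v + κ a
        κ-yva = trans (κ-+ (y ℕ.+ v) a) (cong (_+ κ a) (κ-+ y v))

        U≡ : U ≡ κ y + κ v - κ a
        U≡ = begin
          κ t - κ c                           ≡⟨ l₁ (κ t) (κ c) (κ a) ⟩
          κ t + κ a - (κ c + κ a)             ≡⟨ cong (_- (κ c + κ a)) (κ-+ t a) ⟨
          κ (t ℕ.+ a) - (κ c + κ a)           ≡⟨ cong (λ z → κ z - (κ c + κ a)) (ℕ.m+[n∸m]≡n (ℕ.<⇒≤ y+c<t+a)) ⟨
          κ (y ℕ.+ c ℕ.+ v) - (κ c + κ a)     ≡⟨ cong (_- (κ c + κ a)) (trans (κ-+ (y ℕ.+ c) v) (cong (_+ κ v) (κ-+ y c))) ⟩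
          κ y + κ c + κ v - (κ c + κ a)       ≡⟨ l₃ (κ y) (κ c) (κ v) (κ a) ⟩
          κ y + κ v - κ a                     ∎
          where
          l₁ : ∀ t c a → t - c ≡ t + a - (c + a)
          l₁ = solve 3 (λ t c a → t :- c := t :+ a :- (c :+ a)) refl
          l₃ : ∀ y c v a → y + c + v - (c + a) ≡ y + v - a
          l₃ = solve 4 (λ y c v a → y :+ c :+ v :- (c :+ a) := y :+ v :- a) refl

        1+x-x₀ : κ (suc x) - x₀ ≡ κ (y ℕ.+ v ℕ.+ a) * j
        1+x-x₀ = begin
          κ (suc x) - x₀                      ≡⟨ cong (_- x₀) (κ-+ 1 x) ⟩
          1ℚ + κ x - x₀                       ≡⟨ l₁ (κ x) x₀ ⟩
          1ℚ - (x₀ - κ x)                     ≡⟨ cong₂ _-_ (sym (trans (cong (_* j) (sym (κ2* a))) 2aj≡1)) x₀-x ⟩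
          (κ a + κ a) * j - - (U * j)         ≡⟨ cong (λ z → (κ a + κ a) * j - - (z * j)) U≡ ⟩
          (κ a + κ a) * j - - ((κ y + κ v - κ a) * j) ≡⟨ l₃ (κ a) j (κ y) (κ v) ⟩
          (κ y + κ v + κ a) * j               ≡⟨ cong (_* j) κ-yva ⟨
          κ (y ℕ.+ v ℕ.+ a) * j               ∎
          where
          l₁ : ∀ x z → 1ℚ + x - z ≡ 1ℚ - (z - x)
          l₁ = solve 2 (λ x z → con 1ℚ :+ x :- z := con 1ℚ :- (z :- x)) refl
          l₃ : ∀ a j y v → (a + a) * j - - ((y + v - a) * j) ≡ (y + v + a) * j
          l₃ = solve 4 (λ a j y v → (a :+ a) :* j :- :- ((y :+ v :- a) :* j) := (y :+ v :+ a) :* j) refl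

        l : ∀ y v a j → (y + v + a) * j * ((y + v + a) * j)
          ≡ ((y + v - a) * (y + v - a) + κ 4 * (a * y)) * (j * j) + κ 4 * (a * v) * (j * j)
        l = solve 4 (λ y v a j → (y :+ v :+ a) :* j :* ((y :+ v :+ a) :* j)
          := ((y :+ v :- a) :* (y :+ v :- a) :+ con (κ 4) :* (a :* y)) :* (j :* j) :+ con (κ 4) :* (a :* v) :* (j :* j)) refl
        l₂ : ∀ d r j w → d * (r * r) * (j * j) + w ≡ d * (r * j * (r * j)) + w
        l₂ = solve 4 (λ d r j w → d :* (r :* r) :* (j :* j) :+ w := d :* (r :* j :* (r :* j)) :+ w) refl

open Roots

-- Purely periodic expansions

open import Data.Fin.Base using (zero; suc; toℕ)
open import Data.Fin.Properties using (toℕ-injective; toℕ-fromℕ<; toℕ<n)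
import Data.List.Relation.Unary.All as ListAll
open ListAll using ([]; _∷_)
open import Data.Nat.Base
open import Data.Nat.Divisibility using (∣-refl)
open import Data.Nat.DivMod using (_mod_; _%_; m%n<n; [m+n]%n≡m%n; m<n⇒m%n≡m)
open import Data.Nat.Properties
open import Data.Nat.Tactic.RingSolver using (solve-∀)
open import Data.Rational.Base as ℚ using (ℚ; 1ℚ)
import Data.Rational.Properties as ℚ
open import Data.Rational.Solver using (module +-*-Solver)
open import Data.Vec.Base using (Vec; []; _∷_; lookup; toList; fromList)
open import Data.Vec.Membership.Propositional.Properties using (∈-lookup)
open import Data.Vec.Properties using (toList∘fromList)
open import Data.Vec.Relation.Unary.All as All using (All)
open import Data.Vec.Relation.Unary.All.Properties using (fromList⁺)

-- The matrices of the successive periods are conjugate, so they share the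
-- discriminant δ R², and their fixed points are the complete quotients.
module _ {δ R n} (v : Vec ℕ (suc n)) (0<v : ∀ i → 0 < lookup v i) (disc : Disc δ R (word (toList v))) where
  private
    digit : ℕ → ℕ
    digit k = lookup v (k mod suc n)

    block : ℕ → ℕ → Mat
    block k zero    = I
    block k (suc l) = quot (digit k) (block (suc k) l)

    mod-cong : ∀ {k l} → k % suc n ≡ l % suc n → k mod suc n ≡ l mod suc n
    mod-cong {k} {l} eq = toℕ-injective (trans (toℕ-fromℕ< (m%n<n k (suc n))) (trans eq (sym (toℕ-fromℕ< (m%n<n l (suc n))))))

    digit-periodic : ∀ k → digit (suc k + n) ≡ digit k
    digit-periodic k = cong (lookup v) (mod-cong {suc k + n} {k} (trans (cong (_% suc n) (sym (+-suc k n))) ([m+n]%n≡m%n k (suc n))))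

    digit-toℕ : ∀ i → digit (toℕ i) ≡ lookup v i
    digit-toℕ i = cong (lookup v) (toℕ-injective (trans (toℕ-fromℕ< (m%n<n (toℕ i) (suc n))) (m<n⇒m%n≡m (toℕ<n i))))

    block-admissible : ∀ k l → Admissible (block k l)
    block-admissible k zero    = I-admissible
    block-admissible k (suc l) = quot-admissible (0<v (k mod suc n)) (block-admissible (suc k) l)

    block-∷ʳ : ∀ k l → block k (suc l) ≡ block k l ⊗ quot (digit (k + l)) I
    block-∷ʳ k zero    = trans (cong (λ i → quot (digit i) I) (sym (+-identityʳ k))) (sym (I-⊗ _))
    block-∷ʳ k (suc l) = begin
      quot (digit k) (block (suc k) (suc l))                             ≡⟨ cong (quot (digit k)) (block-∷ʳ (suc k) l) ⟩
      quot (digit k) (block (suc k) l ⊗ quot (digit (suc k + l)) I)      ≡⟨ quot-⊗ (digit k) (block (suc k) l) _ ⟨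
      block k (suc l) ⊗ quot (digit (suc k + l)) I                       ≡⟨ cong (λ i → block k (suc l) ⊗ quot (digit i) I) (+-suc k l) ⟨
      block k (suc l) ⊗ quot (digit (k + suc l)) I                       ∎
      where open ≡-Reasoning

    block≡word : ∀ {l} (w : Vec ℕ l) k → (∀ i → digit (k + toℕ i) ≡ lookup w i) → block k l ≡ word (toList w)
    block≡word []      k eq = refl
    block≡word (x ∷ w) k eq = cong₂ quot (trans (cong digit (sym (+-identityʳ k))) (eq zero))
      (block≡word w (suc k) (λ i → trans (cong digit (sym (+-suc k (toℕ i)))) (eq (suc i))))

    period-from : ℕ → Mat
    period-from k = block k (suc n)

    -- The digit at place k recurs n + 1 places later, so moving it to the end of the block gives
    -- the block that starts one place later.
    rotation : ∀ k → rotate (digit k) (block (suc k) n) ≡ period-from (suc k)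
    rotation k = begin
      rotate (digit k) (block (suc k) n)               ≡⟨ ⊗-quot-I (digit k) (block (suc k) n) ⟨
      block (suc k) n ⊗ quot (digit k) I               ≡⟨ cong (λ x → block (suc k) n ⊗ quot x I) (digit-periodic k) ⟨
      block (suc k) n ⊗ quot (digit (suc k + n)) I     ≡⟨ block-∷ʳ (suc k) n ⟨
      period-from (suc k)                              ∎
      where open ≡-Reasoning

    period₀ : period-from 0 ≡ word (toList v)
    period₀ = block≡word v 0 digit-toℕ

    disc-from : ∀ k → Disc δ R (period-from k)
    disc-from zero    = subst (Disc δ R) (sym period₀) disc
    disc-from (suc k) = subst (Disc δ R) (rotation k) (rotate-disc {δ} {R} (digit k) (block (suc k) n) (disc-from k))

    corner : ∀ k l → 0 < Mat.a₁₁ (block k l)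
    corner k l = Admissible.corner (block-admissible k l)

    -- The rotated matrix again belongs to a period that begins with a positive digit.
    rows : ∀ k → let open Mat (rotate (digit k) (block (suc k) n)) in a₂₁ + a₂₂ < a₁₁ + a₁₂
    rows k = subst (λ M → let open Mat M in a₂₁ + a₂₂ < a₁₁ + a₁₂) (sym (rotation k))
      (quot-rows {digit (suc k)} {block (suc (suc k)) n} (0<v (suc k mod suc n)) (block-admissible (suc (suc k)) n))

    lower : ∀ k → 0 < Mat.a₂₁ (rotate (digit k) (block (suc k) n))
    lower k = subst (λ M → 0 < Mat.a₂₁ M) (sym (rotation k)) (corner (suc (suc k)) n)

  periodic-expansion : root {δ} R (word (toList v)) ≡[ v ]‾
  periodic-expansion = record
    { completeQuotient = λ k → root R (period-from k)
    ; start            = cong (root R) period₀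
    ; floor-≤          = λ k → floor-≤ {δ} {R} (digit k) (block (suc k) n) (disc-from k) (corner (suc k) n)
    ; floor-<          = λ k → floor-< {δ} {R} (digit k) (block (suc k) n) (disc-from k) (corner (suc k) n) (rows k)
    ; step             = λ k → subst (λ M → (root {δ} R (period-from k) Defs.- Defs.fromℕ (digit k)) Defs.* root {δ} R M ≡ Defs.fromℚ 1ℚ)
        (rotation k) (root-step {δ} {R} (digit k) (block (suc k) n) (disc-from k) (corner (suc k) n) (lower k))
    }

-- Increasing sequences and comparison of fractions

increasing⇒mono : ∀ (f : ℕ → ℚ) → (∀ n → f n ℚ.< f (suc n)) → ∀ {m n} → m < n → f m ℚ.< f n
increasing⇒mono f f< {m} {suc n} m<1+n =
  [ (λ m<n → ℚ.<-trans (increasing⇒mono f f< m<n) (f< n)) , (λ { refl → f< n }) ]′ (m<1+n⇒m<n∨m≡n m<1+n)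

increasing⇒injective : ∀ (f : ℕ → ℚ) → (∀ n → f n ℚ.< f (suc n)) → ∀ {m n} → f m ≡ f n → m ≡ n
increasing⇒injective f f< {m} {n} eq with <-cmp m n
... | tri< m<n _ _ = ⊥-elim (ℚ.<-irrefl eq (increasing⇒mono f f< m<n))
... | tri≈ _ m≡n _ = m≡n
... | tri> _ _ n<m = ⊥-elim (ℚ.<-irrefl (sym eq) (increasing⇒mono f f< n<m))

κ-mono : ∀ {m n} → m < n → κ m ℚ.< κ n
κ-mono {m} {n} m<n = begin-strict
  κ m                     ≡⟨ ℚ.+-identityʳ (κ m) ⟨
  κ m ℚ.+ ℚ.0ℚ            <⟨ ℚ.+-monoʳ-< (κ m) (0<κ (m<n⇒0<n∸m m<n)) ⟩
  κ m ℚ.+ κ (n ∸ m)       ≡⟨ κ-+ m (n ∸ m) ⟨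
  κ (m + (n ∸ m))         ≡⟨ cong κ (m+[n∸m]≡n (<⇒≤ m<n)) ⟩
  κ n                     ∎
  where open ℚ.≤-Reasoning

fraction-< : ∀ {m n p q} → 0 < p → 0 < q → m * q < n * p → κ m ℚ.* recip p ℚ.< κ n ℚ.* recip q
fraction-< {m} {n} {p} {q} 0<p 0<q mq<np = subst₂ ℚ._<_ left right
  (ℚ.*-monoˡ-<-pos (recip p ℚ.* recip q) {{ℚ.positive (0<p*q (0<recip 0<p) (0<recip 0<q))}} (κ-mono mq<np))
  where
  open ≡-Reasoning
  open +-*-Solver using (solve; _:=_; _:*_)
  left : κ (m * q) ℚ.* (recip p ℚ.* recip q) ≡ κ m ℚ.* recip p
  left = begin
    κ (m * q) ℚ.* (recip p ℚ.* recip q)             ≡⟨ cong (ℚ._* (recip p ℚ.* recip q)) (κ-* m q) ⟩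
    κ m ℚ.* κ q ℚ.* (recip p ℚ.* recip q)           ≡⟨ solve 4 (λ a b c d → a :* b :* (c :* d) := a :* c :* (b :* d)) refl (κ m) (κ q) (recip p) (recip q) ⟩
    κ m ℚ.* recip p ℚ.* (κ q ℚ.* recip q)           ≡⟨ cong (κ m ℚ.* recip p ℚ.*_) (κ*recip 0<q) ⟩
    κ m ℚ.* recip p ℚ.* 1ℚ                          ≡⟨ ℚ.*-identityʳ _ ⟩
    κ m ℚ.* recip p                                 ∎
  right : κ (n * p) ℚ.* (recip p ℚ.* recip q) ≡ κ n ℚ.* recip q
  right = begin
    κ (n * p) ℚ.* (recip p ℚ.* recip q)             ≡⟨ cong (ℚ._* (recip p ℚ.* recip q)) (κ-* n p) ⟩
    κ n ℚ.* κ p ℚ.* (recip p ℚ.* recip q)           ≡⟨ solve 4 (λ a b c d → a :* b :* (c :* d) := a :* d :* (b :* c)) refl (κ n) (κ p) (recip p) (recip q) ⟩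
    κ n ℚ.* recip q ℚ.* (κ p ℚ.* recip p)           ≡⟨ cong (κ n ℚ.* recip q ℚ.*_) (κ*recip 0<p) ⟩
    κ n ℚ.* recip q ℚ.* 1ℚ                          ≡⟨ ℚ.*-identityʳ _ ⟩
    κ n ℚ.* recip q                                 ∎

fraction-cancel : ∀ {m n k} → 0 < k → 0 < n → κ (k * m) ℚ.* recip (k * n) ≡ κ m ℚ.* recip n
fraction-cancel {m} {n} {k} 0<k 0<n = begin
  κ (k * m) ℚ.* recip (k * n)                                   ≡⟨ cong (ℚ._* recip (k * n)) (κ-* k m) ⟩
  κ k ℚ.* κ m ℚ.* recip (k * n)                                 ≡⟨ ℚ.*-identityʳ _ ⟨
  κ k ℚ.* κ m ℚ.* recip (k * n) ℚ.* 1ℚ                          ≡⟨ cong (κ k ℚ.* κ m ℚ.* recip (k * n) ℚ.*_) (κ*recip 0<n) ⟨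
  κ k ℚ.* κ m ℚ.* recip (k * n) ℚ.* (κ n ℚ.* recip n)           ≡⟨ solve 5 (λ k m x n y → k :* m :* x :* (n :* y) := m :* y :* (k :* n :* x)) refl (κ k) (κ m) (recip (k * n)) (κ n) (recip n) ⟩
  κ m ℚ.* recip n ℚ.* (κ k ℚ.* κ n ℚ.* recip (k * n))           ≡⟨ cong (λ z → κ m ℚ.* recip n ℚ.* (z ℚ.* recip (k * n))) (κ-* k n) ⟨
  κ m ℚ.* recip n ℚ.* (κ (k * n) ℚ.* recip (k * n))             ≡⟨ cong (κ m ℚ.* recip n ℚ.*_) (κ*recip (*-mono-< 0<k 0<n)) ⟩
  κ m ℚ.* recip n ℚ.* 1ℚ                                        ≡⟨ ℚ.*-identityʳ _ ⟩
  κ m ℚ.* recip n                                               ∎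
  where
  open ≡-Reasoning
  open +-*-Solver using (solve; _:=_; _:*_)

approx : ∀ {δ s t} (u : IsUnit δ s t) → Norm1 u → 2 ≤ List.length t → Approx δ s
approx {t = zero ∷ _}      u norm1 _ with () ∷ _ ← ListAll.map proj₁ (IsUnit.digits u)
approx {t = suc z ∷ c ∷ r} u norm1 _ = record { z = z ; c = c ; r = r ; isUnit = u ; norm1 = norm1 }
approx {t = _ ∷ []}        u norm1 (s≤s ())

-- The infinite family in ℚ(√δ)

module Family (δ s′ : ℕ) (s²<δ : suc s′ * suc s′ < δ) (δ<[1+s]² : δ < suc (suc s′) * suc (suc s′)) where
  private
    s = suc s′

    length-double² : ∀ t → 2 ≤ List.length (double s (double s t))
    length-double² []          = s≤s (s≤s z≤n)
    length-double² (_ ∷ [])    = s≤s (s≤s z≤n)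
    length-double² (_ ∷ _ ∷ _) = s≤s (s≤s z≤n)

  doubled : Approx δ s → Approx δ s
  doubled α = record { isUnit = double-isUnit z<s isUnit ; norm1 = double-norm1 z<s isUnit }
    where open Approx α

  -- One doubling already makes the norm 1, but turns an empty t into a single digit; the second
  -- ensures at least two digits.
  first : (∃[ t ] IsUnit δ s t) → Approx δ s
  first (t , u) = approx (double-isUnit z<s u′) (double-norm1 z<s u′) (length-double² t)
    where u′ = double-isUnit z<s u

  approxAt : ℕ → Approx δ s
  approxAt zero    = first (Reduction.unit δ s s²<δ δ<[1+s]² z<s)
  approxAt (suc n) = doubled (approxAt n)

  ratio : Approx δ s → ℚ
  ratio α = κ e ℚ.* recip p
    where open Approx α

  0<p : ∀ (α : Approx δ s) → 0 < Approx.p α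
  0<p α = <-≤-trans (Approx.0<e α) (≤-trans (m≤m+n _ _) (m≤n+m _ (Approx.f α)))

  ratio-doubled : ∀ α → ratio α ℚ.< ratio (doubled α)
  ratio-doubled α = fraction-< {Approx.e α} {Approx.e (doubled α)} (0<p α) (0<p (doubled α)) (double-ratio z<s isUnit norm1)
    where open Approx α

  value : Approx δ s → ℚ[√ δ ]
  value α = root (4 * (p * e)) (word (1 ∷ period′ α))
    where open Approx α

  -- The coefficient of √δ is R / 2c with R = 4 p e and c = 2 p², that is e / p; these ratios
  -- increase, which tells the values apart.
  im-value : ∀ α → Defs.im (value α) ≡ ratio α
  im-value α = begin
    κ (4 * (p * e)) ℚ.* recip (2 * Mat.a₂₁ (word (1 ∷ period′ α)))     ≡⟨ cong (λ x → κ (4 * (p * e)) ℚ.* recip (2 * x)) (period-corner α) ⟩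
    κ (4 * (p * e)) ℚ.* recip (2 * (2 * (p * p)))                       ≡⟨ cong₂ (λ x y → κ x ℚ.* recip y) (l₁ p e) (l₂ p) ⟩
    κ (4 * p * e) ℚ.* recip (4 * p * p)                                 ≡⟨ fraction-cancel (*-mono-< (z<s {3}) (0<p α)) (0<p α) ⟩
    ratio α                                                             ∎
    where
    open Approx α
    open ≡-Reasoning
    l₁ : ∀ p e → 4 * (p * e) ≡ 4 * p * e
    l₁ = solve-∀
    l₂ : ∀ p → 2 * (2 * (p * p)) ≡ 4 * p * p
    l₂ = solve-∀

  value-periodic : ∀ α → ∃[ n ] Σ[ a ∈ Vec ℕ (suc n) ] All (Digit (4 * s + 1)) a × value α ≡[ a ]‾
  value-periodic α = _ , a , digits , subst (λ t → root {δ} R (word t) ≡[ a ]‾) (toList∘fromList (1 ∷ period′ α))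
    (periodic-expansion {δ} {R} a (λ i → proj₁ (All.lookup digits (∈-lookup i a)))
      (subst (λ t → Disc δ R (word t)) (sym (toList∘fromList (1 ∷ period′ α))) (period-disc α)))
    where
    a = fromList (1 ∷ period′ α)
    R = 4 * (Approx.p α * Approx.e α)
    digits : All (Digit (4 * s + 1)) a
    digits = fromList⁺ (period-digits α)

  infinitely-many : InfinitelyMany (λ (x : ℚ[√ δ ]) →
    ∃[ n ] Σ[ a ∈ Vec ℕ (suc n) ] All (Digit (4 * s + 1)) a × x ≡[ a ]‾)
  infinitely-many = (λ n → value (approxAt n)) , injective , (λ n → value-periodic (approxAt n))
    where
    injective : ∀ {m n} → value (approxAt m) ≡ value (approxAt n) → m ≡ n
    injective {m} {n} eq = increasing⇒injective (λ n → ratio (approxAt n)) (λ n → ratio-doubled (approxAt n))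
      (trans (sym (im-value (approxAt m))) (trans (cong Defs.im eq) (im-value (approxAt n))))

square-squarefree⇒≡1 : ∀ {n} → Squarefree (n * n) → n * n ≡ 1
square-squarefree⇒≡1 {n} sf = cong (λ x → x * x) (sf n ∣-refl)

-- The square root is a variable here so that it can be split: s = 0 contradicts δ ≥ 2, and s² = δ
-- would force the squarefree δ to be 1, so s² < δ strictly.
bounded-by : ∀ {δ} s → 2 ≤ δ → Squarefree δ → s * s ≤ δ × δ < suc s * suc s →
  InfinitelyMany (λ (x : ℚ[√ δ ]) →
    ∃[ n ] Σ[ a ∈ Vec ℕ (suc n) ] All (Digit (4 * s + 1)) a × x ≡[ a ]‾)
bounded-by zero 2≤δ _ (_ , δ<1) = ⊥-elim (<⇒≱ δ<1 (<⇒≤ 2≤δ))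
bounded-by {δ} (suc s′) 2≤δ sf (s²≤δ , δ<[1+s]²) = Family.infinitely-many δ s′ (≤∧≢⇒< s²≤δ s²≢δ) δ<[1+s]²
  where
  s²≢δ : suc s′ * suc s′ ≢ δ
  s²≢δ refl = <⇒≢ 2≤δ (sym (square-squarefree⇒≡1 {suc s′} sf))

mainTheorem7 : ∀ (δ : ℕ) → 2 ≤ δ → Squarefree δ →
    InfinitelyMany (λ (x : ℚ[√ δ ]) →
      ∃[ n ] Σ[ a ∈ Vec ℕ (suc n) ]
        All (λ aᵢ → 1 ≤ aᵢ × aᵢ ≤ 4 * ⌊√ δ ⌋ + 1) a × x ≡[ a ]‾)
mainTheorem7 δ 2≤δ sf = bounded-by ⌊√ δ ⌋ 2≤δ sf (⌊√⌋-spec δ)
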